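{- Let $\mathcal{H}_2$ be the class of $2$-vertex extremal minimal bipartite matching covered graphs and $\mathcal{H}_3$ the class of $2$-vertex $n$-extremal minimal bipartite matching covered graphs. Then $\mathcal{H}_3\subset\mathcal{H}_2$ (a proper containment).
   Context: All graphs are finite and loopless; parallel edges are allowed. For a graph $G=(V,E)$ write $n=|V|$ and $m=|E|$. A connected graph on four or more vertices is matching covered if every edge lies in some perfect matching. A matching covered graph is minimal if deleting any single edge yields a graph that is not matching covered. $V_2$ is the set of vertices of degree two. A minimal bipartite matching covered graph is $2$-vertex extremal if $|V_2|=2(m-n+2)$, and $2$-vertex $n$-extremal if $|V_2|=\frac n2+2$. Classes are regarded up to isomorphism. -}

module Defs where

open import Data.Bool using (Bool)
open import Data.Fin using (Fin; punchIn)
open import Data.Fin.Properties using (_≟_)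
open import Data.Fin.Subset using (Subset; _∈_)
open import Data.Integer as ℤ using (ℤ; +_)
open import Data.List using (List; length; filter; allFin)
open import Data.Nat as ℕ using (ℕ; zero; suc; _≥_; _/_)
open import Data.Product using (_×_; ∃; ∃!; proj₁; proj₂)
open import Data.Sum using (_⊎_)
open import Function using (_∘_)
open import Level using (0ℓ)
open import Relation.Binary.Construct.Closure.ReflexiveTransitive using (Star)
open import Relation.Binary.PropositionalEquality using (_≡_; _≢_)
open import Relation.Nullary using (¬_; Dec)
open import Relation.Nullary.Decidable using (_⊎-dec_)
open import Relation.Unary using (Pred)

-- Every finite graph is isomorphic to one with vertex set Fin n and edge
-- set Fin m.  Distinct edges may have the same ends (parallel edges); the
-- order of the two ends of an edge carries no meaning.
record Graph : Set where
  constructor mkGraph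
  field
    n        : ℕ
    m        : ℕ
    ends     : Fin m → Fin n × Fin n
    loopless : ∀ e → proj₁ (ends e) ≢ proj₂ (ends e)

open Graph public

Vertex : Graph → Set
Vertex G = Fin (n G)

Edge : Graph → Set
Edge G = Fin (m G)

Incident : (G : Graph) → Vertex G → Edge G → Set
Incident G v e = v ≡ proj₁ (ends G e) ⊎ v ≡ proj₂ (ends G e)

incident? : (G : Graph) (v : Vertex G) (e : Edge G) → Dec (Incident G v e)
incident? G v e = (v ≟ proj₁ (ends G e)) ⊎-dec (v ≟ proj₂ (ends G e))

-- In a loopless graph the degree is the number of incident edges, parallel
-- edges being counted separately.
degree : (G : Graph) → Vertex G → ℕ
degree G v = length (filter (incident? G v) (allFin (m G)))

V₂ : (G : Graph) → List (Vertex G)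
V₂ G = filter (λ v → degree G v ℕ.≟ 2) (allFin (n G))

∣V₂∣ : Graph → ℕ
∣V₂∣ G = length (V₂ G)

Adjacent : (G : Graph) → Vertex G → Vertex G → Set
Adjacent G u v = u ≢ v × ∃ λ e → Incident G u e × Incident G v e

Connected : Pred Graph 0ℓ
Connected G = ∀ u v → Star (Adjacent G) u v

Bipartite : Pred Graph 0ℓ
Bipartite G = ∃ λ (colour : Vertex G → Bool) →
  ∀ e → colour (proj₁ (ends G e)) ≢ colour (proj₂ (ends G e))

PerfectMatching : (G : Graph) → Pred (Subset (m G)) 0ℓ
PerfectMatching G M = ∀ v → ∃! _≡_ λ e → e ∈ M × Incident G v e

MatchingCovered : Pred Graph 0ℓ
MatchingCovered G =
  Connected G × n G ≥ 4 × (∀ e → ∃ λ M → PerfectMatching G M × e ∈ M)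

-- The vertex set is kept; the remaining edges are renumbered by punchIn e.
delete : (G : Graph) → Edge G → Graph
delete (mkGraph n (suc m) ends loopless) e =
  mkGraph n m (ends ∘ punchIn e) (loopless ∘ punchIn e)

Minimal : Pred Graph 0ℓ
Minimal G = MatchingCovered G × (∀ e → ¬ MatchingCovered (delete G e))

MinimalBipartite : Pred Graph 0ℓ
MinimalBipartite G = Bipartite G × Minimal G

-- Stated over ℤ, so that the subtraction is not truncated.
TwoVertexExtremal : Pred Graph 0ℓ
TwoVertexExtremal G = + ∣V₂∣ G ≡ + 2 ℤ.* (+ m G ℤ.- + n G ℤ.+ + 2)

-- A matching covered graph has a perfect matching, so n is even and the
-- division is exact on the graphs to which this is applied.
TwoVertexNExtremal : Pred Graph 0ℓ
TwoVertexNExtremal G = ∣V₂∣ G ≡ n G / 2 ℕ.+ 2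

-- These predicates are invariant under isomorphism, so containment of
-- predicates is containment of the classes taken up to isomorphism.
H₂ : Pred Graph 0ℓ
H₂ G = MinimalBipartite G × TwoVertexExtremal G

H₃ : Pred Graph 0ℓ
H₃ G = MinimalBipartite G × TwoVertexNExtremal G

{-# OPTIONS --safe #-}
module Submission where

-- Containment.  In a matching covered graph all degrees are at least 2, so
-- 3n ≤ 2m + |V₂| by handshaking, while every minimal bipartite one satisfies
-- |V₂| ≥ 2(m − n + 2).  Adding the two gives |V₂| ≥ n/2 + 2, and equality here
-- forces equality in both.
--
-- The lower bound is |A₂| ≥ m − n + 2 for each colour class A, where A₂ is the
-- set of its vertices of degree two.  Direct every edge from its A-end (tail) to
-- its B-end (head).  By minimality every edge e is the only edge that leaves some
-- vertex set W(e) closed under every perfect matching avoiding e.  Fix a root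
-- r ∈ A₂ and assign to an edge e whose tail is not in A₂ ∖ r its head if r ∈ W(e),
-- and its tail otherwise.  A vertex of degree at least 3 is assigned at most once:
-- for two edges e, f with a common tail (head) a perfect matching through a third
-- edge shows that W(e) ∪ W(f) is everything (that W(e) ∩ W(f) is empty).
-- Contracting a ― b ― a' whenever b ∈ B has degree two and a, a' have degree at
-- least three makes the assignment injective, and r itself is never assigned;
-- counting edges yields m − 2|A₂ ∖ r| ≤ n − 1 − |A₂ ∖ r|.
--
-- Properness.  Joining the corresponding leaves of two stars K₁,₄ gives n = 10,
-- m = 12 and |V₂| = 8.

open import Defs
open import Data.Bool as Bool using (Bool; true; false; not; if_then_else_)
open import Data.Bool.Properties using (not-injective)
open import Data.Empty using (⊥)
open import Data.Fin using (Fin; zero; suc; punchIn; punchOut; quotRem)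
open import Data.Fin.Patterns
open import Data.Fin.Properties using (_≟_; suc-injective; any?; all?; punchIn-punchOut; punchInᵢ≢i)
open import Data.Fin.Subset using (Subset; _∈_)
open import Data.Fin.Subset.Properties using (_∈?_)
import Data.Integer as ℤ
open import Data.Integer.Solver using () renaming (module +-*-Solver to ℤ-Solver)
open import Data.List as List using (length; filter)
open import Data.Nat as ℕ using (ℕ; zero; suc; _+_; _*_; _∸_; _/_; _≤_; _<_; _≥_; z≤n; s≤s; _≤?_; _<?_)
open import Data.Nat.DivMod using (m/n*n≤m)
open import Data.Nat.Properties
  using (+-*-semiring; +-mono-≤; +-monoˡ-≤; +-monoʳ-≤; ≤-refl; ≤-trans; ≤-reflexive; ≤-antisym;
         m≤m+n; m≤n+m; +-identityʳ; +-cancelˡ-≤; +-cancelʳ-≤; +-cancelʳ-≡; +-comm; +-assoc;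
         +-suc; *-identityʳ; *-identityˡ; *-zeroʳ; *-comm; *-assoc; *-distribʳ-+; *-mono-≤;
         *-monoʳ-≤; *-cancelˡ-≤; m∸n+n≡m; 0∸n≡0; <-trans; <-≤-trans; <-irrefl; ≤-pred; n<1⇒n≡0;
         ≰⇒>; ≤⇒≯; module ≤-Reasoning)
  renaming (suc-injective to ℕ-suc-injective)
open import Data.Nat.Solver using (module +-*-Solver)
open import Data.Product using (_×_; _,_; ∃; proj₁; proj₂)
open import Data.Sum using (_⊎_; inj₁; inj₂; [_,_]′; swap)
open import Data.Unit using (⊤; tt)
open import Data.Vec using (Vec; []; _∷_; lookup; tabulate)
open import Data.Vec.Properties using (lookup∘tabulate; lookup⇒[]=; []=⇒lookup)
open import Function using (_∘_; id)
open import Level using (Level; 0ℓ)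
open import Relation.Binary using (Rel)
open import Relation.Binary.Construct.Closure.ReflexiveTransitive
  using (Star; _◅_; _◅◅_; kleisliStar; reverse) renaming (ε to nil)
open import Relation.Binary.PropositionalEquality
open import Relation.Nullary using (¬_; Dec; yes; no; does; contradiction)
open import Relation.Nullary.Decidable using (_×-dec_; _⊎-dec_; _→-dec_; ¬?; dec-true; from-yes)
open import Relation.Unary using (Pred; Decidable; _⊆_; _⊂_)
open import Algebra.Properties.Semiring.Sum +-*-semiring
  using (sum; sum-cong-≗; ∑-distrib-+; ∑-comm; sum-remove; *-distribˡ-sum)

-- Counting decidable predicates

⟦_⟧ : {A : Set} → Dec A → ℕ
⟦ a? ⟧ = if does a? then 1 else 0

⟦⟧-yes : {A : Set} (a? : Dec A) → A → ⟦ a? ⟧ ≡ 1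
⟦⟧-yes (yes _) _ = refl
⟦⟧-yes (no ¬a) a = contradiction a ¬a

⟦⟧-no : {A : Set} (a? : Dec A) → ¬ A → ⟦ a? ⟧ ≡ 0
⟦⟧-no (yes a) ¬a = contradiction a ¬a
⟦⟧-no (no _)  _  = refl

⟦⟧-positive : {A : Set} (a? : Dec A) → 1 ≤ ⟦ a? ⟧ → A
⟦⟧-positive (yes a) _ = a

does-true : {A : Set} (a? : Dec A) → does a? ≡ true → A
does-true (yes a) _ = a

⟦⟧-mono : {A B : Set} (a? : Dec A) (b? : Dec B) → (A → B) → ⟦ a? ⟧ ≤ ⟦ b? ⟧
⟦⟧-mono (yes a) b? f = ≤-reflexive (sym (⟦⟧-yes b? (f a)))
⟦⟧-mono (no _)  _  _ = z≤n

⟦⟧-cong : {A B : Set} (a? : Dec A) (b? : Dec B) → (A → B) → (B → A) → ⟦ a? ⟧ ≡ ⟦ b? ⟧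
⟦⟧-cong a? b? f g = ≤-antisym (⟦⟧-mono a? b? f) (⟦⟧-mono b? a? g)

⟦⟧-⊎ : {A B C : Set} (a? : Dec A) (b? : Dec B) (c? : Dec C) →
       (A → B ⊎ C) → ⟦ a? ⟧ ≤ ⟦ b? ⟧ + ⟦ c? ⟧
⟦⟧-⊎ (no _)  _ _ _ = z≤n
⟦⟧-⊎ (yes a) b? c? f with f a
... | inj₁ b = ≤-trans (≤-reflexive (sym (⟦⟧-yes b? b))) (m≤m+n _ _)
... | inj₂ c = ≤-trans (≤-reflexive (sym (⟦⟧-yes c? c))) (m≤n+m _ ⟦ b? ⟧)

⟦⟧-disjoint-⊎ : {A B C : Set} (a? : Dec A) (b? : Dec B) (c? : Dec C) →
  (A → B ⊎ C) → (B → A) → (C → A) → (B → ¬ C) → ⟦ a? ⟧ ≡ ⟦ b? ⟧ + ⟦ c? ⟧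
⟦⟧-disjoint-⊎ a? (yes b) c? _ g _ d =
  trans (⟦⟧-yes a? (g b)) (cong suc (sym (⟦⟧-no c? (d b))))
⟦⟧-disjoint-⊎ a? (no ¬b) c? f _ h _ = ⟦⟧-cong a? c? split h
  where
  split : _ → _
  split a with f a
  ... | inj₁ b = contradiction b ¬b
  ... | inj₂ c = c

⟦⟧-× : {A B : Set} (a? : Dec A) (b? : Dec B) → ⟦ a? ⟧ * ⟦ b? ⟧ ≡ ⟦ a? ×-dec b? ⟧
⟦⟧-× (yes _) b? = +-identityʳ ⟦ b? ⟧
⟦⟧-× (no _)  _  = refl

sum-mono-≤ : ∀ {n} (f g : Fin n → ℕ) → (∀ i → f i ≤ g i) → sum f ≤ sum g
sum-mono-≤ {zero}  f g f≤g = z≤n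
sum-mono-≤ {suc n} f g f≤g = +-mono-≤ (f≤g zero) (sum-mono-≤ (f ∘ suc) (g ∘ suc) (f≤g ∘ suc))

-- A strict term could not be made up for by the others. `balance` uses this to pass from equal
-- totals to each single edge.
sum-≤-tight : ∀ {n} (f g : Fin n → ℕ) → (∀ i → f i ≤ g i) → sum g ≤ sum f → ∀ i → g i ≤ f i
sum-≤-tight {suc n} f g f≤g Σg≤Σf zero =
  +-cancelʳ-≤ (sum (f ∘ suc)) _ _
    (≤-trans (+-monoʳ-≤ (g zero) (sum-mono-≤ (f ∘ suc) (g ∘ suc) (f≤g ∘ suc))) Σg≤Σf)
sum-≤-tight {suc n} f g f≤g Σg≤Σf (suc i) =
  sum-≤-tight (f ∘ suc) (g ∘ suc) (f≤g ∘ suc)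
    (+-cancelˡ-≤ (g zero) _ _ (≤-trans Σg≤Σf (+-monoˡ-≤ (sum (f ∘ suc)) (f≤g zero)))) i

sum-zero : ∀ {n} (f : Fin n → ℕ) → (∀ i → f i ≡ 0) → sum f ≡ 0
sum-zero {zero}  f f≡0 = refl
sum-zero {suc n} f f≡0 = cong₂ _+_ (f≡0 zero) (sum-zero (f ∘ suc) (f≡0 ∘ suc))

sum-one : ∀ n → sum {n} (λ _ → 1) ≡ n
sum-one zero    = refl
sum-one (suc n) = cong suc (sum-one n)

sum-positive : ∀ {n} (f : Fin n → ℕ) → 1 ≤ sum f → ∃ λ i → 1 ≤ f i
sum-positive {suc n} f 1≤Σ with f zero in eq
... | suc _ = zero , subst (1 ≤_) (sym eq) (s≤s z≤n)
... | zero with sum-positive (f ∘ suc) 1≤Σ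
...   | i , 1≤fi = suc i , 1≤fi

term≤sum : ∀ {n} (f : Fin n → ℕ) i → f i ≤ sum f
term≤sum f zero    = m≤m+n _ _
term≤sum f (suc i) = ≤-trans (term≤sum (f ∘ suc) i) (m≤n+m _ (f zero))

terms≤sum : ∀ {n} (f : Fin n → ℕ) {i j} → i ≢ j → f i + f j ≤ sum f
terms≤sum f {zero}  {zero}  i≢j = contradiction refl i≢j
terms≤sum f {zero}  {suc j} i≢j = +-monoʳ-≤ (f zero) (term≤sum (f ∘ suc) j)
terms≤sum f {suc i} {zero}  i≢j =
  ≤-trans (≤-reflexive (+-comm (f (suc i)) _)) (+-monoʳ-≤ (f zero) (term≤sum (f ∘ suc) i))
terms≤sum f {suc i} {suc j} i≢j =
  ≤-trans (terms≤sum (f ∘ suc) (i≢j ∘ cong suc)) (m≤n+m _ (f zero))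

sum-select : ∀ {n} (j : Fin n) (c : Fin n → ℕ) → sum (λ i → ⟦ i ≟ j ⟧ * c i) ≡ c j
sum-select zero c =
  trans (cong₂ _+_ (+-identityʳ (c zero)) (sum-zero (λ i → ⟦ suc i ≟ zero ⟧ * c (suc i)) (λ _ → refl)))
        (+-identityʳ (c zero))
sum-select (suc j) c = trans (sum-cong-≗ shift) (sum-select j (c ∘ suc))
  where
  shift : ∀ i → ⟦ suc i ≟ suc j ⟧ * c (suc i) ≡ ⟦ i ≟ j ⟧ * c (suc i)
  shift i = cong (_* c (suc i)) (⟦⟧-cong (suc i ≟ suc j) (i ≟ j) suc-injective (cong suc))

sum-indicator : ∀ {n} (j : Fin n) → sum (λ i → ⟦ i ≟ j ⟧) ≡ 1
sum-indicator j = trans (sum-cong-≗ (λ i → sym (*-identityʳ ⟦ i ≟ j ⟧))) (sum-select j (λ _ → 1))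

# : ∀ {n} {P : Pred (Fin n) 0ℓ} → Decidable P → ℕ
# P? = sum (λ i → ⟦ P? i ⟧)

#-remove : ∀ {n} {P : Pred (Fin n) 0ℓ} (P? : Decidable P) {j} → P j →
           # P? ≡ suc (# (λ i → P? i ×-dec ¬? (i ≟ j)))
#-remove {P = P} P? {j} Pj = begin
  # P?
    ≡⟨ sum-cong-≗ (λ i → ⟦⟧-disjoint-⊎ (P? i) (i ≟ j) (P? i ×-dec ¬? (i ≟ j))
         (split i) (λ { refl → Pj }) proj₁ (λ { i≡j (_ , i≢j) → i≢j i≡j })) ⟩
  sum (λ i → ⟦ i ≟ j ⟧ + ⟦ P? i ×-dec ¬? (i ≟ j) ⟧)
    ≡⟨ ∑-distrib-+ (λ i → ⟦ i ≟ j ⟧) _ ⟩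
  sum (λ i → ⟦ i ≟ j ⟧) + # (λ i → P? i ×-dec ¬? (i ≟ j))
    ≡⟨ cong (_+ # (λ i → P? i ×-dec ¬? (i ≟ j))) (sum-indicator j) ⟩
  suc (# (λ i → P? i ×-dec ¬? (i ≟ j))) ∎
  where
  open ≡-Reasoning
  split : ∀ i → P i → i ≡ j ⊎ (P i × i ≢ j)
  split i Pi with i ≟ j
  ... | yes i≡j = inj₁ i≡j
  ... | no i≢j  = inj₂ (Pi , i≢j)

-- Counts the edges assigned to tails and to heads; `φ` has to be injective on `S` only.
#-injection : ∀ {m n} {S : Pred (Fin m) 0ℓ} {R : Pred (Fin n) 0ℓ}
  (S? : Decidable S) (R? : Decidable R) (φ : Fin m → Fin n) →
  (∀ {i} → S i → R (φ i)) → (∀ {i j} → S i → S j → φ i ≡ φ j → i ≡ j) → # S? ≤ # R?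
#-injection {zero}  S? R? φ image inj = z≤n
#-injection {suc m} S? R? φ image inj with S? zero
... | no _   = #-injection (S? ∘ suc) R? (φ ∘ suc) image (λ s s' eq → suc-injective (inj s s' eq))
... | yes s₀ = ≤-trans (s≤s (#-injection (S? ∘ suc) (λ i → R? i ×-dec ¬? (i ≟ φ zero)) (φ ∘ suc)
                 (λ s → image s , λ eq → contradiction (inj s s₀ eq) (λ ()))
                 (λ s s' eq → suc-injective (inj s s' eq))))
               (≤-reflexive (sym (#-remove R? (image s₀))))

-- The assignment of edges to vertices, and contraction

-- P and Q are the parts of a vertex set in A and in B.
record Region (n : ℕ) : Set₁ where
  field
    P  : Pred (Fin n) 0ℓ
    P? : Decidable P
    Q  : Pred (Fin n) 0ℓ
    Q? : Decidable Q

module _ {m n : ℕ} {𝓜 : Set} (_∈M_ : Fin m → 𝓜 → Set) where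

  -- ε and β are the edges and the B-vertices that have not been contracted away.
  -- κ holds of the remaining A-vertices of degree at least three, except the root.
  -- The perfect matchings 𝓜 are those of the original graph throughout: an edge
  -- of a matching that was contracted is merely no longer in ε.
  record Shape : Set₁ where
    field
      ε    : Pred (Fin m) 0ℓ
      ε?   : Decidable ε
      β    : Pred (Fin n) 0ℓ
      β?   : Decidable β
      κ    : Pred (Fin n) 0ℓ
      κ?   : Decidable κ
      tail : Fin m → Fin n
      head : Fin m → Fin n

    Forward : Region n → Set
    Forward Z = ∀ {g} → ε g → P (tail g) → Q (head g)
      where open Region Z

    ForwardExcept : Fin m → Region n → Set
    ForwardExcept h Z = ∀ {g} → ε g → g ≢ h → P (tail g) → Q (head g)
      where open Region Z

    Backward : 𝓜 → Region n → Set
    Backward M Z = ∀ {g} → ε g → g ∈M M → Q (head g) → P (tail g)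
      where open Region Z

  -- The set W(h): `h` is the only edge that leaves it, and a matching that avoids `h` does not
  -- enter it.
  record CutOf (S : Shape) (h : Fin m) : Set₁ where
    open Shape S
    field
      region : Region n
    open Region region public
    field
      tail∈    : P (tail h)
      head∉    : ¬ Q (head h)
      forward  : ForwardExcept h region
      backward : ∀ M → ¬ h ∈M M → Backward M region

  record Config (r : Fin n) : Set₁ where
    field
      shape : Shape
    open Shape shape public
    Cut : Fin m → Set₁
    Cut = CutOf shape
    module Cut {h} (c : Cut h) = CutOf c
    field
      head∈β      : ∀ {h} → ε h → β (head h)
      root∉κ      : ¬ κ r
      covered     : ∀ {h} → ε h → ∃ λ M → h ∈M M
      tail-unique : ∀ {M g h} → ε g → ε h → g ∈M M → h ∈M M → tail g ≡ tail h → g ≡ h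
      head-unique : ∀ {M g h} → ε g → ε h → g ∈M M → h ∈M M → head g ≡ head h → g ≡ h
      head-cover  : ∀ M {b} → β b → ∃ λ g → ε g × g ∈M M × head g ≡ b
      -- What is kept of connectivity: a region that no edge leaves and no edge of `M` enters is
      -- compared with the root.
      strong      : ∀ M (Z : Region n) → Forward Z → Backward M Z → ∀ {h} → ε h →
                    (Region.P Z (tail h) → Region.P Z r) × (Region.P Z r → Region.Q Z (head h))
      cut         : ∀ {h} → ε h → Cut h
      -- Degree at least three, in the form in which the arguments consume it.
      third       : ∀ {g h} → ε g → ε h → tail g ≡ tail h → κ (tail g) →
                    ∃ λ k → ε k × tail k ≡ tail g × k ≢ g × k ≢ h

    Counted : Pred (Fin m) 0ℓ
    Counted g = ε g × (κ (tail g) ⊎ tail g ≡ r)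

    Counted? : Decidable Counted
    Counted? g = ε? g ×-dec (κ? (tail g) ⊎-dec (tail g ≟ r))

    -- The result of an injective assignment: at most one edge for each vertex of `κ` and each
    -- vertex of `β`.
    Bound : Set
    Bound = # Counted? ≤ # κ? + # β?

    -- The path a ― b ― a' of the overview: its middle vertex has no further edge, and both of its
    -- ends lie in `κ`.
    Contractible : Fin m → Fin m → Set
    Contractible e e' =
      ε e × ε e' × e ≢ e' × head e ≡ head e' × κ (tail e) × κ (tail e') ×
      (∀ g → ε g → head g ≡ head e → g ≡ e ⊎ g ≡ e')

    contractible? : ∀ e e' → Dec (Contractible e e')
    contractible? e e' =
      ε? e ×-dec ε? e' ×-dec ¬? (e ≟ e') ×-dec (head e ≟ head e') ×-dec
      κ? (tail e) ×-dec κ? (tail e') ×-dec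
      all? (λ g → ε? g →-dec ((head g ≟ head e) →-dec ((g ≟ e) ⊎-dec (g ≟ e'))))

    -- An edge parallel to `e` would leave the region of `e` too, but `e` is the only edge that
    -- does.
    no-parallel : ∀ {e e'} → ε e → ε e' → tail e ≡ tail e' → head e ≡ head e' → e ≡ e'
    no-parallel {e} {e'} εe εe' t≡ h≡ with e ≟ e'
    ... | yes e≡e' = e≡e'
    ... | no e≢e'  = contradiction (subst Q (sym h≡) (forward εe' (e≢e' ∘ sym) (subst P t≡ tail∈))) head∉
      where open Cut (cut εe)

  -- Configurations without contractible pairs

  module Terminal {r} (C : Config r) (none-contractible : ∀ e e' → ¬ Config.Contractible C e e') where
    open Config C

    -- ε g may have several proofs; the region consulted is that of the proof given
    -- by ε?.
    Side : ∀ {g} → Dec (ε g) → Set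
    Side (yes εg) = Cut.P (cut εg) r
    Side (no _)   = ⊥

    -- Outward edges are assigned to their heads, all other counted edges to their tails.
    Outward : Pred (Fin m) 0ℓ
    Outward g = Side (ε? g)

    Outward? : Decidable Outward
    Outward? g with ε? g
    ... | yes εg = Cut.P? (cut εg) r
    ... | no _   = no λ ()

    outward-cut : ∀ {g} → Outward g → ∃ λ (c : Cut g) → Cut.P c r
    outward-cut {g} out with ε? g
    ... | yes εg = cut εg , out

    inward-cut : ∀ {g} → ε g → ¬ Outward g → ∃ λ (c : Cut g) → ¬ Cut.P c r
    inward-cut {g} εg ¬out with ε? g
    ... | yes εg' = cut εg' , ¬out
    ... | no ¬εg  = contradiction εg ¬εg

    -- If `g` and `h` were the only edges at their head, they would be contractible. This is the
    -- counterpart of `third` on the B side and the purpose of contracting.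
    third-at-head : ∀ {g h} → ε g → ε h → g ≢ h → head g ≡ head h → κ (tail g) → κ (tail h) →
                    ∃ λ k → ε k × head k ≡ head g × k ≢ g × k ≢ h
    third-at-head {g} {h} εg εh g≢h hd κg κh
      with any? (λ k → ε? k ×-dec (head k ≟ head g) ×-dec ¬? (k ≟ g) ×-dec ¬? (k ≟ h))
    ... | yes found = found
    ... | no none   = contradiction (εg , εh , g≢h , hd , κg , κh , only) (none-contractible g h)
      where
      only : ∀ k → ε k → head k ≡ head g → k ≡ g ⊎ k ≡ h
      only k εk hk with k ≟ g | k ≟ h
      ... | yes k≡g | _       = inj₁ k≡g
      ... | no _    | yes k≡h = inj₂ k≡h
      ... | no k≢g  | no k≢h  = contradiction (k , εk , hk , k≢g , k≢h) none

    -- If one edge starts at the root, it starts inside the region of the other and so puts the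
    -- common head there. Otherwise the two regions are intersected: for the same reason neither `g`
    -- nor `h` leaves the intersection, and a matching through a third edge at the head avoids both,
    -- so it does not enter. The intersection contains the root and would have to contain the head
    -- of `g`.
    outward-injective : ∀ {g h} → Counted g × Outward g → Counted h × Outward h →
                        head g ≡ head h → g ≡ h
    outward-injective {g} {h} ((εg , κg) , og) ((εh , κh) , oh) hd with g ≟ h
    ... | yes g≡h = g≡h
    ... | no g≢h  = contradiction hd (clash κg κh)
      where
      module G = Cut (proj₁ (outward-cut og))
      module H = Cut (proj₁ (outward-cut oh))

      clash : κ (tail g) ⊎ tail g ≡ r → κ (tail h) ⊎ tail h ≡ r → head g ≢ head h
      clash (inj₂ tg≡r) _ hd = H.head∉ (subst H.Q hd
        (H.forward εg g≢h (subst H.P (sym tg≡r) (proj₂ (outward-cut oh)))))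
      clash _ (inj₂ th≡r) hd = G.head∉ (subst G.Q (sym hd)
        (G.forward εh (g≢h ∘ sym) (subst G.P (sym th≡r) (proj₂ (outward-cut og)))))
      clash (inj₁ κg) (inj₁ κh) hd = G.head∉ (proj₁ (proj₂ (strong M Z fwd bwd εg) root∈))
        where
        k   = proj₁ (third-at-head εg εh g≢h hd κg κh)
        εk  = proj₁ (proj₂ (third-at-head εg εh g≢h hd κg κh))
        k-props = proj₂ (proj₂ (third-at-head εg εh g≢h hd κg κh))
        M   = proj₁ (covered εk)
        k∈M = proj₂ (covered εk)

        Z : Region n
        Z = record { P = λ v → G.P v × H.P v ; P? = λ v → G.P? v ×-dec H.P? v
                   ; Q = λ v → G.Q v × H.Q v ; Q? = λ v → G.Q? v ×-dec H.Q? v }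

        root∈ = proj₂ (outward-cut og) , proj₂ (outward-cut oh)

        fwd : Forward Z
        fwd {f} εf (Gf , Hf) with f ≟ g | f ≟ h
        ... | no f≢g   | no f≢h  = G.forward εf f≢g Gf , H.forward εf f≢h Hf
        ... | yes refl | _       = contradiction (subst H.Q hd (H.forward εf g≢h Hf)) H.head∉
        ... | no _     | yes refl = contradiction (subst G.Q (sym hd) (G.forward εf (g≢h ∘ sym) Gf)) G.head∉

        bwd : Backward M Z
        bwd εf f∈M (Gf , Hf) =
          G.backward M (λ g∈M → proj₁ (proj₂ k-props) (head-unique εk εg k∈M g∈M (proj₁ k-props))) εf f∈M Gf ,
          H.backward M (λ h∈M → proj₂ (proj₂ k-props)
            (head-unique εk εh k∈M h∈M (trans (proj₁ k-props) hd))) εf f∈M Hf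

    -- An edge at the root has the root in its region and is therefore outward, so the root never
    -- receives an edge.
    inward-tail : ∀ {g} → Counted g × ¬ Outward g → κ (tail g)
    inward-tail ((_  , inj₁ κg) , _)  = κg
    inward-tail ((εg , inj₂ tg≡r) , ¬og) with inward-cut εg ¬og
    ... | c , r∉ = contradiction (subst (Cut.P c) tg≡r (Cut.tail∈ c)) r∉

    -- Dual to `outward-injective`, with the union: the common tail lies in both regions, so each of
    -- `g` and `h` stays inside the region of the other. A matching through a third edge at the tail
    -- does not enter the union, which would then contain the root.
    inward-injective : ∀ {g h} → Counted g × ¬ Outward g → Counted h × ¬ Outward h →
                       tail g ≡ tail h → g ≡ h
    inward-injective {g} {h} ig@((εg , _) , ¬og) ih@((εh , _) , ¬oh) tl with g ≟ h
    ... | yes g≡h = g≡h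
    ... | no g≢h with third εg εh tl (inward-tail ig)
    ...   | k , εk , tk , k≢g , k≢h =
      contradiction (proj₁ (strong M Z fwd bwd εg) (inj₁ G.tail∈))
                    [ proj₂ (inward-cut εg ¬og) , proj₂ (inward-cut εh ¬oh) ]′
      where
      module G = Cut (proj₁ (inward-cut εg ¬og))
      module H = Cut (proj₁ (inward-cut εh ¬oh))
      M   = proj₁ (covered εk)
      k∈M = proj₂ (covered εk)

      Z : Region n
      Z = record { P = λ v → G.P v ⊎ H.P v ; P? = λ v → G.P? v ⊎-dec H.P? v
                 ; Q = λ v → G.Q v ⊎ H.Q v ; Q? = λ v → G.Q? v ⊎-dec H.Q? v }

      fwd : Forward Z
      fwd {f} εf (inj₁ Gf) with f ≟ g
      ... | no f≢g   = inj₁ (G.forward εf f≢g Gf)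
      ... | yes refl = inj₂ (H.forward εf g≢h (subst H.P (sym tl) H.tail∈))
      fwd {f} εf (inj₂ Hf) with f ≟ h
      ... | no f≢h   = inj₂ (H.forward εf f≢h Hf)
      ... | yes refl = inj₁ (G.forward εf (g≢h ∘ sym) (subst G.P tl G.tail∈))

      bwd : Backward M Z
      bwd εf f∈M (inj₁ Gf) = inj₁ (G.backward M (λ g∈M → k≢g (tail-unique εk εg k∈M g∈M tk)) εf f∈M Gf)
      bwd εf f∈M (inj₂ Hf) = inj₂ (H.backward M
        (λ h∈M → k≢h (tail-unique εk εh k∈M h∈M (trans tk tl))) εf f∈M Hf)

    bound : Bound
    bound = begin
      # Counted?
        ≤⟨ sum-mono-≤ (λ g → ⟦ Counted? g ⟧) _ (λ g →
             ⟦⟧-⊎ (Counted? g) (Inward? g) (Counted? g ×-dec Outward? g) (split g)) ⟩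
      sum (λ g → ⟦ Inward? g ⟧ + ⟦ Counted? g ×-dec Outward? g ⟧)
        ≡⟨ ∑-distrib-+ (λ g → ⟦ Inward? g ⟧) _ ⟩
      # Inward? + # (λ g → Counted? g ×-dec Outward? g)
        ≤⟨ +-mono-≤ (#-injection Inward? κ? tail inward-tail inward-injective)
                    (#-injection (λ g → Counted? g ×-dec Outward? g) β? head
                       (λ c → head∈β (proj₁ (proj₁ c))) outward-injective) ⟩
      # κ? + # β? ∎
      where
      open ≤-Reasoning
      Inward? : Decidable (λ g → Counted g × ¬ Outward g)
      Inward? g = Counted? g ×-dec ¬? (Outward? g)

      split : ∀ g → Counted g → (Counted g × ¬ Outward g) ⊎ (Counted g × Outward g)
      split g cg with Outward? g
      ... | yes og = inj₂ (cg , og)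
      ... | no ¬og = inj₁ (cg , ¬og)

  -- Contracting a pair of edges

  Contractible-sym : ∀ {r} (C : Config r) (let open Config C) {e e'} →
                     Contractible e e' → Contractible e' e
  Contractible-sym C (εe , εe' , e≢e' , hd , κe , κe' , only) =
    εe' , εe , e≢e' ∘ sym , sym hd , κe' , κe , λ g εg hg → swap (only g εg (trans hg (sym hd)))

  module _ {r} (C : Config r) where
    open Config C

    -- A matching that uses another edge at the tail of e' must match the common
    -- head of e and e' by e.
    cross : ∀ {e e' h} → Contractible e e' → (c : Cut h) → h ≢ e → h ≢ e' → ∀ M → ¬ h ∈M M →
            ∀ {g} → ε g → g ∈M M → g ≢ e' → tail g ≡ tail e' → Cut.P c (tail e') → Cut.P c (tail e)
    cross {e} {e'} (εe , εe' , e≢e' , hd , κe , κe' , only) c h≢e h≢e' M h∉M {g} εg g∈M g≢e' tg Pe'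
      with head-cover M (head∈β εe)
    ... | k , εk , k∈M , hk with only k εk hk
    ...   | inj₁ refl = backward M h∉M εe k∈M (subst Q (sym hd) (forward εe' (h≢e' ∘ sym) Pe'))
      where open Cut c
    ...   | inj₂ refl = contradiction (tail-unique εg εe' g∈M k∈M tg) g≢e'

    -- A third edge `k` at the tail of `h` provides a matching that avoids `h`, to which `cross`
    -- applies.
    cross-from-tail : ∀ {e e' h} → Contractible e e' → (c : Cut h) → ε h → h ≢ e → h ≢ e' →
                      tail h ≡ tail e' → Cut.P c (tail e)
    cross-from-tail bad@(εe , εe' , e≢e' , hd , κe , κe' , only) c εh h≢e h≢e' th
      with third εh εe' th (subst κ (sym th) κe')
    ... | k , εk , tk , k≢h , k≢e' =
      cross bad c h≢e h≢e' (proj₁ (covered εk))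
        (λ h∈M → k≢h (tail-unique εk εh (proj₂ (covered εk)) h∈M tk))
        εk (proj₂ (covered εk)) k≢e' (trans tk th) (subst P th tail∈)
      where open Cut c

  module Contract {r} (C : Config r) {e e'} (bad : Config.Contractible C e e') where
    open Config C

    private
      εe   = proj₁ bad
      εe'  = proj₁ (proj₂ bad)
      e≢e' = proj₁ (proj₂ (proj₂ bad))
      hd   = proj₁ (proj₂ (proj₂ (proj₂ bad)))
      κe   = proj₁ (proj₂ (proj₂ (proj₂ (proj₂ bad))))
      κe'  = proj₁ (proj₂ (proj₂ (proj₂ (proj₂ (proj₂ bad)))))
      only = proj₂ (proj₂ (proj₂ (proj₂ (proj₂ (proj₂ bad)))))
      a = tail e
      a' = tail e'
      b = head e

    a≢a' : a ≢ a'
    a≢a' a≡a' = e≢e' (no-parallel εe εe' a≡a' hd)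

    r≢a' : r ≢ a'
    r≢a' r≡a' = root∉κ (subst κ (sym r≡a') κe')

    merge : Fin n → Fin n
    merge v with v ≟ a'
    ... | yes _ = a
    ... | no _  = v

    merge-a' : ∀ {v} → v ≡ a' → merge v ≡ a
    merge-a' {v} v≡a' with v ≟ a'
    ... | yes _    = refl
    ... | no v≢a'  = contradiction v≡a' v≢a'

    merge-other : ∀ {v} → v ≢ a' → merge v ≡ v
    merge-other {v} v≢a' with v ≟ a'
    ... | yes v≡a' = contradiction v≡a' v≢a'
    ... | no _     = refl

    merge≢a' : ∀ v → merge v ≢ a'
    merge≢a' v with v ≟ a'
    ... | yes _   = a≢a'
    ... | no v≢a' = v≢a'

    merge≡a : ∀ {v} → merge v ≡ a → v ≡ a ⊎ v ≡ a'
    merge≡a {v} eq with v ≟ a'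
    ... | yes v≡a' = inj₂ v≡a'
    ... | no _     = inj₁ eq

    merge≢a : ∀ {v} → merge v ≢ a → merge v ≡ v
    merge≢a {v} ne with v ≟ a'
    ... | yes _ = contradiction refl ne
    ... | no _  = refl

    -- Vertices keep their names in `Fin n`: `a'` is identified with `a` through `merge`, and `a'`
    -- and `b` are merely struck from `κ` and `β`.
    shape' : Shape
    shape' = record
      { ε    = λ g → ε g × g ≢ e × g ≢ e'
      ; ε?   = λ g → ε? g ×-dec ¬? (g ≟ e) ×-dec ¬? (g ≟ e')
      ; β    = λ v → β v × v ≢ b
      ; β?   = λ v → β? v ×-dec ¬? (v ≟ b)
      ; κ    = λ v → κ v × v ≢ a'
      ; κ?   = λ v → κ? v ×-dec ¬? (v ≟ a')
      ; tail = merge ∘ tail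
      ; head = head
      }
    module S' = Shape shape'

    head≢b : ∀ {g} → S'.ε g → head g ≢ b
    head≢b {g} (εg , g≢e , g≢e') hg = [ g≢e , g≢e' ]′ (only g εg hg)

    -- If `g` and `h` occupy `a` and `a'`, the matching can use neither `e` nor `e'`, and then `b`
    -- is uncovered.
    tail-unique' : ∀ {M g h} → S'.ε g → S'.ε h → g ∈M M → h ∈M M → S'.tail g ≡ S'.tail h → g ≡ h
    tail-unique' {M} {g} {h} (εg , g≢e , g≢e') (εh , h≢e , h≢e') g∈M h∈M eq
      with tail g ≟ tail h
    ... | yes tl = tail-unique εg εh g∈M h∈M tl
    ... | no tl≢ = contradiction (head-cover M (head∈β εe)) uncovered
      where
      both : (tail g ≡ a × tail h ≡ a') ⊎ (tail g ≡ a' × tail h ≡ a)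
      both with tail g ≟ a' | tail h ≟ a'
      ... | yes p | yes q = contradiction (trans p (sym q)) tl≢
      ... | yes p | no _  = inj₂ (p , sym eq)
      ... | no _  | yes q = inj₁ (eq , q)
      ... | no _  | no _  = contradiction eq tl≢

      uncovered : ¬ (∃ λ k → ε k × k ∈M M × head k ≡ b)
      uncovered (k , εk , k∈M , hk) with only k εk hk | both
      ... | inj₁ refl | inj₁ (p , _) = g≢e (tail-unique εg εe g∈M k∈M p)
      ... | inj₁ refl | inj₂ (_ , q) = h≢e (tail-unique εh εe h∈M k∈M q)
      ... | inj₂ refl | inj₁ (_ , q) = h≢e' (tail-unique εh εe' h∈M k∈M q)
      ... | inj₂ refl | inj₂ (p , _) = g≢e' (tail-unique εg εe' g∈M k∈M p)

    head-cover' : ∀ M {v} → S'.β v → ∃ λ g → S'.ε g × g ∈M M × head g ≡ v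
    head-cover' M (βv , v≢b) with head-cover M βv
    ... | g , εg , g∈M , refl =
      g , (εg , (λ { refl → v≢b refl }) , (λ { refl → v≢b (sym hd) })) , g∈M , refl

    -- The region is lifted by letting `a'` and `b` belong to it exactly when `a` does, so that `e`
    -- and `e'` neither leave nor enter it.
    strong' : ∀ M (Z : Region n) → S'.Forward Z → S'.Backward M Z → ∀ {h} → S'.ε h →
              (Region.P Z (S'.tail h) → Region.P Z r) × (Region.P Z r → Region.Q Z (head h))
    strong' M Z fwd bwd {h} ε'h =
      (λ Ph → subst P (merge-other r≢a') (proj₁ (strong M Z↑ fwd↑ bwd↑ (proj₁ ε'h)) Ph)) ,
      (λ Pr → unlift (proj₂ (strong M Z↑ fwd↑ bwd↑ (proj₁ ε'h)) (subst P (sym (merge-other r≢a')) Pr)))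
      where
      open Region Z

      Z↑ : Region n
      Z↑ = record
        { P = P ∘ merge ; P? = λ v → P? (merge v)
        ; Q = λ v → (v ≡ b × P a) ⊎ (v ≢ b × Q v)
        ; Q? = λ v → ((v ≟ b) ×-dec P? a) ⊎-dec (¬? (v ≟ b) ×-dec Q? v)
        }

      unlift : Region.Q Z↑ (head h) → Q (head h)
      unlift (inj₁ (hh , _)) = contradiction hh (head≢b ε'h)
      unlift (inj₂ (_ , q))  = q

      fwd↑ : Forward Z↑
      fwd↑ {g} εg Pg with g ≟ e | g ≟ e'
      ... | yes refl | _        = inj₁ (refl , subst P (merge-other a≢a') Pg)
      ... | no _     | yes refl = inj₁ (sym hd , subst P (merge-a' refl) Pg)
      ... | no g≢e   | no g≢e'  = inj₂ (head≢b (εg , g≢e , g≢e') , fwd (εg , g≢e , g≢e') Pg)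

      bwd↑ : Backward M Z↑
      bwd↑ {g} εg g∈M (inj₁ (hg , Pa)) with only g εg hg
      ... | inj₁ refl = subst P (sym (merge-other a≢a')) Pa
      ... | inj₂ refl = subst P (sym (merge-a' refl)) Pa
      bwd↑ {g} εg g∈M (inj₂ (hg≢b , Qg)) =
        bwd (εg , (λ { refl → hg≢b refl }) , (λ { refl → hg≢b (sym hd) })) g∈M Qg

    -- The region is made compatible with merging a and a' by removing a unless a'
    -- belongs to it as well; cross shows that it remains closed.
    cut' : ∀ {h} → S'.ε h → CutOf shape' h
    cut' {h} (εh , h≢e , h≢e') = record
      { region   = record
        { P = λ v → P v × (v ≡ a → P a') ; P? = λ v → P? v ×-dec ((v ≟ a) →-dec P? a')
        ; Q = Q ; Q? = Q? }
      ; tail∈    = tail∈'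
      ; head∉    = head∉
      ; forward  = forward'
      ; backward = backward'
      }
      where
      c = cut εh
      open Cut c

      tail∈' : P (merge (tail h)) × (merge (tail h) ≡ a → P a')
      tail∈' with tail h ≟ a'
      ... | yes th = cross-from-tail C bad c εh h≢e h≢e' th , λ _ → subst P th tail∈
      ... | no _   = tail∈ , λ th → cross-from-tail C (Contractible-sym C bad) c εh h≢e' h≢e th

      forward' : ∀ {g} → S'.ε g → g ≢ h → P (merge (tail g)) × (merge (tail g) ≡ a → P a') → Q (head g)
      forward' {g} (εg , _) g≢h (Pg , Pa') with tail g ≟ a'
      ... | yes tg = forward εg g≢h (subst P (sym tg) (Pa' refl))
      ... | no _   = forward εg g≢h Pg

      backward' : ∀ M → ¬ h ∈M M → ∀ {g} → S'.ε g → g ∈M M → Q (head g) →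
                  P (merge (tail g)) × (merge (tail g) ≡ a → P a')
      backward' M h∉M {g} (εg , g≢e , g≢e') g∈M Qg with tail g ≟ a'
      ... | yes tg = cross C bad c h≢e h≢e' M h∉M εg g∈M g≢e' tg Pa' , λ _ → Pa'
        where Pa' = subst P tg (backward M h∉M εg g∈M Qg)
      ... | no _ = backward M h∉M εg g∈M Qg ,
        λ tg → cross C (Contractible-sym C bad) c h≢e' h≢e M h∉M εg g∈M g≢e tg
                 (subst P tg (backward M h∉M εg g∈M Qg))

    -- If `g` and `h` start on the same side, any further edge on the other side will do; if they
    -- start on different sides, `a` still has an edge besides `e` and the one of them given there.
    third-merged : ∀ {g h} → ε g → ε h → tail g ≡ a ⊎ tail g ≡ a' → tail h ≡ a ⊎ tail h ≡ a' →
                   ∃ λ k → S'.ε k × S'.tail k ≡ a × k ≢ g × k ≢ h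
    third-merged εg εh (inj₁ tg) (inj₁ th) with third εe' εe' refl κe'
    ... | k , εk , tk , k≢e' , _ =
      k , (εk , differ refl , k≢e') , merge-a' tk , differ tg , differ th
      where
      differ : ∀ {f} → tail f ≡ a → k ≢ f
      differ tf refl = a≢a' (trans (sym tf) tk)
    third-merged εg εh (inj₂ tg) (inj₂ th) with third εe εe refl κe
    ... | k , εk , tk , k≢e , _ =
      k , (εk , k≢e , differ refl) , trans (cong merge tk) (merge-other a≢a') , differ tg , differ th
      where
      differ : ∀ {f} → tail f ≡ a' → k ≢ f
      differ tf refl = a≢a' (trans (sym tk) tf)
    third-merged εg εh (inj₁ tg) (inj₂ th) with third εe εg (sym tg) κe
    ... | k , εk , tk , k≢e , k≢g =
      k , (εk , k≢e , differ refl) , trans (cong merge tk) (merge-other a≢a') , k≢g , differ th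
      where
      differ : ∀ {f} → tail f ≡ a' → k ≢ f
      differ tf refl = a≢a' (trans (sym tk) tf)
    third-merged εg εh (inj₂ tg) (inj₁ th) with third-merged εh εg (inj₁ th) (inj₂ tg)
    ... | k , ε'k , tk , k≢h , k≢g = k , ε'k , tk , k≢g , k≢h

    third' : ∀ {g h} → S'.ε g → S'.ε h → S'.tail g ≡ S'.tail h → S'.κ (S'.tail g) →
             ∃ λ k → S'.ε k × S'.tail k ≡ S'.tail g × k ≢ g × k ≢ h
    third' {g} {h} (εg , _) (εh , _) eq (κg , _) with merge (tail g) ≟ a
    ... | yes tg with third-merged εg εh (merge≡a tg) (merge≡a (trans (sym eq) tg))
    ...   | k , ε'k , tk , k≢g , k≢h = k , ε'k , trans tk (sym tg) , k≢g , k≢h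
    third' {g} {h} (εg , _) (εh , _) eq (κg , _) | no tg≢a
      with third εg εh tail-eq (subst κ tail-g κg)
      where
      tail-g = merge≢a tg≢a
      tail-eq : tail g ≡ tail h
      tail-eq = trans (sym tail-g) (trans eq (merge≢a (tg≢a ∘ trans eq)))
    ... | k , εk , tk , k≢g , k≢h =
      k , (εk , differ-e , differ-e') , cong merge tk , k≢g , k≢h
      where
      tail-g = merge≢a tg≢a
      differ-e : k ≢ e
      differ-e refl = tg≢a (trans tail-g (sym tk))
      differ-e' : k ≢ e'
      differ-e' refl = merge≢a' (tail g) (trans tail-g (sym tk))

    contracted : Config r
    contracted = record
      { shape       = shape'
      ; head∈β      = λ ε'h → head∈β (proj₁ ε'h) , head≢b ε'h
      ; root∉κ      = root∉κ ∘ proj₁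
      ; covered     = covered ∘ proj₁
      ; tail-unique = tail-unique'
      ; head-unique = λ ε'g ε'h → head-unique (proj₁ ε'g) (proj₁ ε'h)
      ; head-cover  = head-cover'
      ; strong      = strong'
      ; cut         = cut'
      ; third       = third'
      }

    module C' = Config contracted

    counted-split : ∀ g → Counted g → g ≡ e ⊎ (g ≡ e' ⊎ C'.Counted g)
    counted-split g (εg , t) with g ≟ e | g ≟ e'
    ... | yes g≡e | _        = inj₁ g≡e
    ... | no _    | yes g≡e' = inj₂ (inj₁ g≡e')
    ... | no g≢e  | no g≢e'  = inj₂ (inj₂ ((εg , g≢e , g≢e') , place t))
      where
      place : κ (tail g) ⊎ tail g ≡ r → C'.κ (merge (tail g)) ⊎ merge (tail g) ≡ r
      place (inj₁ κg) with tail g ≟ a'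
      ... | yes _   = inj₁ (κe , a≢a')
      ... | no t≢a' = inj₁ (κg , t≢a')
      place (inj₂ tg≡r) = inj₂ (trans (cong merge tg≡r) (merge-other r≢a'))

    β-count : # β? ≡ suc (# C'.β?)
    β-count = #-remove β? (head∈β εe)

    -- The left side loses at most `e` and `e'`; the right side loses exactly two, `a'` from `κ` and
    -- `b` from `β`.
    lift-bound : C'.Bound → Bound
    lift-bound bound' = begin
      # Counted?
        ≤⟨ sum-mono-≤ (λ g → ⟦ Counted? g ⟧) _ (λ g → ≤-trans
             (⟦⟧-⊎ (Counted? g) (g ≟ e) ((g ≟ e') ⊎-dec C'.Counted? g) (counted-split g))
             (+-monoʳ-≤ ⟦ g ≟ e ⟧
               (⟦⟧-⊎ ((g ≟ e') ⊎-dec C'.Counted? g) (g ≟ e') (C'.Counted? g) id))) ⟩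
      sum (λ g → ⟦ g ≟ e ⟧ + (⟦ g ≟ e' ⟧ + ⟦ C'.Counted? g ⟧))
        ≡⟨ ∑-distrib-+ (λ g → ⟦ g ≟ e ⟧) _ ⟩
      sum (λ g → ⟦ g ≟ e ⟧) + sum (λ g → ⟦ g ≟ e' ⟧ + ⟦ C'.Counted? g ⟧)
        ≡⟨ cong₂ _+_ (sum-indicator e) (∑-distrib-+ (λ g → ⟦ g ≟ e' ⟧) _) ⟩
      suc (sum (λ g → ⟦ g ≟ e' ⟧) + # C'.Counted?)
        ≡⟨ cong (λ x → suc (x + # C'.Counted?)) (sum-indicator e') ⟩
      suc (suc (# C'.Counted?))
        ≤⟨ s≤s (s≤s bound') ⟩
      suc (suc (# C'.κ? + # C'.β?))
        ≡⟨ cong suc (sym (+-suc (# C'.κ?) (# C'.β?))) ⟩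
      suc (# C'.κ?) + suc (# C'.β?)
        ≡⟨ cong₂ _+_ (sym (#-remove κ? κe')) (sym β-count) ⟩
      # κ? + # β? ∎
      where open ≤-Reasoning

  -- Induction on the number of B-vertices left, since every contraction removes one.
  config-bound : ∀ {r} k (C : Config r) → # (Config.β? C) ≡ k → Config.Bound C
  config-bound k C #β with any? (λ e → any? (λ e' → Config.contractible? C e e'))
  config-bound k C #β | no none = Terminal.bound C (λ e e' bad → none (e , e' , bad))
  config-bound zero C #β | yes (_ , _ , bad) = contradiction (trans (sym (Contract.β-count C bad)) #β) λ ()
  config-bound (suc k) C #β | yes (_ , _ , bad) =
    Contract.lift-bound C bad (config-bound k (Contract.contracted C bad)
      (ℕ-suc-injective (trans (sym (Contract.β-count C bad)) #β)))

-- Auxiliary facts on lists, finite choice and products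

length-filter-tabulate : ∀ {n} {A : Set} {P : Pred A 0ℓ} (P? : Decidable P) (f : Fin n → A) →
  length (filter P? (List.tabulate f)) ≡ sum (λ i → ⟦ P? (f i) ⟧)
length-filter-tabulate {zero}  P? f = refl
length-filter-tabulate {suc n} P? f with P? (f zero)
... | yes _ = cong suc (length-filter-tabulate P? (f ∘ suc))
... | no _  = length-filter-tabulate P? (f ∘ suc)

-- Lets a search over all edges return a separation found on the way; `B` is level-polymorphic
-- because separations live in `Set₁`.
all-or : ∀ {n} {ℓ : Level} {A : Fin n → Set} {B : Set ℓ} → (∀ i → A i ⊎ B) → (∀ i → A i) ⊎ B
all-or {zero}  f = inj₁ λ ()
all-or {suc n} {A = A} f with f zero | all-or (f ∘ suc)
... | inj₂ b  | _       = inj₂ b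
... | inj₁ _  | inj₂ b  = inj₂ b
... | inj₁ a₀ | inj₁ as = inj₁ λ { zero → a₀ ; (suc i) → as i }

1≤*ˡ : ∀ x {y} → 1 ≤ x * y → 1 ≤ x
1≤*ˡ (suc x) _ = s≤s z≤n

1≤*ʳ : ∀ x {y} → 1 ≤ x * y → 1 ≤ y
1≤*ʳ x {zero}  1≤ = contradiction (≤-trans 1≤ (≤-reflexive (*-zeroʳ x))) λ ()
1≤*ʳ x {suc y} _  = s≤s z≤n

-- Perfect matchings as edge weights

-- The vertices from which u can be reached; following descend from any of them
-- traces a path without repetitions, since the rank decreases.
record Reach {n} (R : Rel (Fin n) 0ℓ) (u : Fin n) : Set₁ where
  field
    W       : Pred (Fin n) 0ℓ
    W?      : Decidable W
    rank    : Fin n → ℕ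
    target  : W u
    closed  : ∀ {x y} → R x y → W y → W x
    descend : ∀ {x} → W x → x ≡ u ⊎ ∃ λ y → R x y × W y × rank y < rank x

reach : ∀ {n} {R : Rel (Fin n) 0ℓ} → (∀ x y → Dec (R x y)) → ∀ u → Reach R u
reach {n} {R} R? u =
  grow _ (λ v → v ≡ u) (_≟ u) (λ _ → 0) 1 refl (λ _ → s≤s z≤n) inj₁ refl
  where
  -- `k` counts the vertices still outside `W`. An added vertex takes the current `bound` as its
  -- rank, which lies above all earlier ranks.
  grow : ∀ k (W : Pred (Fin n) 0ℓ) (W? : Decidable W) (rank : Fin n → ℕ) bound → W u →
         (∀ {x} → W x → rank x < bound) →
         (∀ {x} → W x → x ≡ u ⊎ ∃ λ y → R x y × W y × rank y < rank x) →
         # (λ v → ¬? (W? v)) ≡ k → Reach R u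
  grow k W W? rank bound Wu rank< descend #k
    with any? (λ x → any? (λ y → ¬? (W? x) ×-dec R? x y ×-dec W? y))
  ... | no none = record
    { W = W ; W? = W? ; rank = rank ; target = Wu ; closed = closed ; descend = descend }
    where
    closed : ∀ {x y} → R x y → W y → W x
    closed {x} {y} Rxy Wy with W? x
    ... | yes Wx = Wx
    ... | no ¬Wx = contradiction (x , y , ¬Wx , Rxy , Wy) none
  grow zero W W? rank bound Wu rank< descend #k | yes (x , _ , ¬Wx , _) =
    contradiction (trans (sym (#-remove (λ v → ¬? (W? v)) ¬Wx)) #k) λ ()
  grow (suc k) W W? rank bound Wu rank< descend #k | yes (x , y , ¬Wx , Rxy , Wy) =
    grow k W⁺ (λ v → W? v ⊎-dec (v ≟ x)) rank⁺ (suc bound) (inj₁ Wu) rank⁺< descend⁺ #⁺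
    where
    W⁺ : Pred (Fin n) 0ℓ
    W⁺ v = W v ⊎ v ≡ x

    rank⁺ : Fin n → ℕ
    rank⁺ v with v ≟ x
    ... | yes _ = bound
    ... | no _  = rank v

    rank⁺-old : ∀ {v} → W v → rank⁺ v ≡ rank v
    rank⁺-old {v} Wv with v ≟ x
    ... | yes refl = contradiction Wv ¬Wx
    ... | no _     = refl

    rank⁺-new : rank⁺ x ≡ bound
    rank⁺-new with x ≟ x
    ... | yes _  = refl
    ... | no x≢x = contradiction refl x≢x

    rank⁺< : ∀ {v} → W⁺ v → rank⁺ v < suc bound
    rank⁺< (inj₁ Wv)   = ≤-trans (≤-reflexive (cong suc (rank⁺-old Wv))) (≤-trans (rank< Wv) (m≤n+m _ 1))
    rank⁺< (inj₂ refl) = ≤-reflexive (cong suc rank⁺-new)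

    descend⁺ : ∀ {v} → W⁺ v → v ≡ u ⊎ ∃ λ z → R v z × W⁺ z × rank⁺ z < rank⁺ v
    descend⁺ (inj₂ refl) =
      inj₂ (y , Rxy , inj₁ Wy , subst₂ _<_ (sym (rank⁺-old Wy)) (sym rank⁺-new) (rank< Wy))
    descend⁺ (inj₁ Wv) with descend Wv
    ... | inj₁ v≡u = inj₁ v≡u
    ... | inj₂ (z , Rvz , Wz , z<v) =
      inj₂ (z , Rvz , inj₁ Wz , subst₂ _<_ (sym (rank⁺-old Wz)) (sym (rank⁺-old Wv)) z<v)

    #⁺ : # (λ v → ¬? (W? v ⊎-dec (v ≟ x))) ≡ k
    #⁺ = ℕ-suc-injective (begin
      suc (# (λ v → ¬? (W? v ⊎-dec (v ≟ x))))
        ≡⟨ cong suc (sum-cong-≗ (λ v → ⟦⟧-cong (¬? (W? v ⊎-dec (v ≟ x))) (¬? (W? v) ×-dec ¬? (v ≟ x))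
             (λ ¬W⁺ → ¬W⁺ ∘ inj₁ , ¬W⁺ ∘ inj₂) (λ { (p , q) → [ p , q ]′ }))) ⟩
      suc (# (λ v → ¬? (W? v) ×-dec ¬? (v ≟ x)))
        ≡⟨ sym (#-remove (λ v → ¬? (W? v)) ¬Wx) ⟩
      # (λ v → ¬? (W? v))
        ≡⟨ #k ⟩
      suc k ∎)
      where open ≡-Reasoning

module _ (G : Graph) where

  inc : Vertex G → Edge G → ℕ
  inc v e = ⟦ incident? G v e ⟧

  load : (Edge G → ℕ) → Vertex G → ℕ
  load w v = sum (λ e → w e * inc v e)

  -- Load one at every vertex forces the weights to be 0 or 1, so these are indicator functions of
  -- perfect matchings, in a form that can be added and exchanged.
  Matched : (Edge G → ℕ) → Set
  Matched w = ∀ v → load w v ≡ 1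

  degree≡sum : ∀ v → degree G v ≡ sum (inc v)
  degree≡sum v = length-filter-tabulate (incident? G v) id

  load-one : ∀ v → load (λ _ → 1) v ≡ degree G v
  load-one v = trans (sum-cong-≗ (λ e → *-identityˡ (inc v e))) (sym (degree≡sum v))

  load-+ : ∀ w w' v → load (λ e → w e + w' e) v ≡ load w v + load w' v
  load-+ w w' v = trans (sum-cong-≗ (λ e → *-distribʳ-+ (inc v e) (w e) (w' e)))
                        (∑-distrib-+ (λ e → w e * inc v e) _)

  load-edge : ∀ f v → load (λ e → ⟦ e ≟ f ⟧) v ≡ inc v f
  load-edge f v = sum-select f (inc v)

  matched-cover : ∀ w → Matched w → ∀ v → ∃ λ e → 1 ≤ w e × Incident G v e
  matched-cover w matched v with sum-positive (λ e → w e * inc v e) (≤-reflexive (sym (matched v)))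
  ... | e , 1≤we = e , 1≤*ˡ (w e) 1≤we , ⟦⟧-positive (incident? G v e) (1≤*ʳ (w e) 1≤we)

  matched-unique : ∀ w → Matched w → ∀ {v e f} → 1 ≤ w e → 1 ≤ w f →
                   Incident G v e → Incident G v f → e ≡ f
  matched-unique w matched {v} {e} {f} 1≤we 1≤wf ve vf with e ≟ f
  ... | yes e≡f = e≡f
  ... | no e≢f = contradiction
    (≤-trans (+-mono-≤ (here 1≤we ve) (here 1≤wf vf))
      (≤-trans (terms≤sum (λ e → w e * inc v e) e≢f) (≤-reflexive (matched v)))) λ { (s≤s ()) }
    where
    here : ∀ {e} → 1 ≤ w e → Incident G v e → 1 ≤ w e * inc v e
    here {e} 1≤we ve = *-mono-≤ 1≤we (≤-reflexive (sym (⟦⟧-yes (incident? G v e) ve)))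

  matching-weight : Subset (m G) → Edge G → ℕ
  matching-weight M e = ⟦ e ∈? M ⟧

  perfect⇒matched : ∀ {M} → PerfectMatching G M → Matched (matching-weight M)
  perfect⇒matched {M} perfect v with perfect v
  ... | e₀ , (e₀∈M , ve₀) , unique = trans (sum-cong-≗ eq) (sum-indicator e₀)
    where
    eq : ∀ e → ⟦ e ∈? M ⟧ * inc v e ≡ ⟦ e ≟ e₀ ⟧
    eq e = trans (⟦⟧-× (e ∈? M) (incident? G v e)) (⟦⟧-cong (e ∈? M ×-dec incident? G v e) (e ≟ e₀)
      (λ e∈M,ve → sym (unique e∈M,ve)) (λ { refl → e₀∈M , ve₀ }))

  support : (Edge G → ℕ) → Subset (m G)
  support w = tabulate (λ e → does (1 ≤? w e))

  support⁺ : ∀ w {e} → 1 ≤ w e → e ∈ support w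
  support⁺ w {e} 1≤we = lookup⇒[]= e (support w)
    (trans (lookup∘tabulate (λ e → does (1 ≤? w e)) e) (dec-true (1 ≤? w e) 1≤we))

  support⁻ : ∀ w {e} → e ∈ support w → 1 ≤ w e
  support⁻ w {e} e∈ = does-true (1 ≤? w e)
    (trans (sym (lookup∘tabulate (λ e → does (1 ≤? w e)) e)) ([]=⇒lookup e∈))

  matched⇒perfect : ∀ w → Matched w → PerfectMatching G (support w)
  matched⇒perfect w matched v with matched-cover w matched v
  ... | e , 1≤we , ve = e , (support⁺ w 1≤we , ve) ,
    λ (f∈ , vf) → matched-unique w matched 1≤we (support⁻ w f∈) ve vf

  AdjacentAvoiding : Edge G → Rel (Vertex G) 0ℓ
  AdjacentAvoiding h u v = u ≢ v × ∃ λ e → e ≢ h × Incident G u e × Incident G v e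

-- A weight that vanishes on `h` keeps all its loads when restricted to the other edges. Minimality
-- makes one of the hypotheses fail, which is how cuts arise.
matching-covered-delete : ∀ G h → (∀ u v → Star (AdjacentAvoiding G h) u v) → n G ≥ 4 →
  (∀ g → g ≢ h → ∃ λ w → Matched G w × 1 ≤ w g × w h ≡ 0) → MatchingCovered (delete G h)
matching-covered-delete G@(mkGraph n (suc m) ends loopless) h connected n≥4 avoid =
  (λ u v → gmap-id (connected u v)) , n≥4 , cover
  where
  G-h = delete G h

  adj : ∀ {u v} → AdjacentAvoiding G h u v → Adjacent G-h u v
  adj (u≢v , e , e≢h , ue , ve) = u≢v , punchOut (e≢h ∘ sym) ,
    subst (Incident G _) (sym (punchIn-punchOut (e≢h ∘ sym))) ue ,
    subst (Incident G _) (sym (punchIn-punchOut (e≢h ∘ sym))) ve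

  gmap-id : ∀ {u v} → Star (AdjacentAvoiding G h) u v → Star (Adjacent G-h) u v
  gmap-id nil      = nil
  gmap-id (a ◅ as) = adj a ◅ gmap-id as

  cover : ∀ e → ∃ λ M → PerfectMatching G-h M × e ∈ M
  cover e with avoid (punchIn h e) (λ eq → punchInᵢ≢i h e eq)
  ... | w , matched , 1≤we , wh≡0 =
    support G-h (w ∘ punchIn h) , matched⇒perfect G-h (w ∘ punchIn h) matched' ,
    support⁺ G-h (w ∘ punchIn h) 1≤we
    where
    matched' : Matched G-h (w ∘ punchIn h)
    matched' v = begin
      load G-h (w ∘ punchIn h) v
        ≡⟨ cong (λ x → x * inc G v h + load G-h (w ∘ punchIn h) v) (sym wh≡0) ⟩
      w h * inc G v h + load G-h (w ∘ punchIn h) v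
        ≡⟨ sym (sum-remove {i = h} (λ e → w e * inc G v e)) ⟩
      load G w v
        ≡⟨ matched v ⟩
      1 ∎
      where open ≡-Reasoning

-- Degrees in matching covered graphs

star-closed : ∀ {G} (S : Pred (Vertex G) 0ℓ) → (∀ {u v} → Adjacent G u v → S u → S v) →
              ∀ {u v} → Star (Adjacent G) u v → S u → S v
star-closed {G} S step nil      Su = Su
star-closed {G} S step (a ◅ as) Su = star-closed {G} S step as (step a Su)

not-two : ∀ {n} → n ≥ 4 → (v w : Fin n) → ¬ (∀ x → x ≡ v ⊎ x ≡ w)
not-two (s≤s (s≤s (s≤s _))) v w only with only zero | only (suc zero) | only (suc (suc zero))
... | inj₁ p | inj₁ q | _      = contradiction (trans p (sym q)) λ ()
... | inj₂ p | inj₂ q | _      = contradiction (trans p (sym q)) λ ()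
... | inj₁ p | inj₂ q | inj₁ t = contradiction (trans p (sym t)) λ ()
... | inj₁ p | inj₂ q | inj₂ t = contradiction (trans q (sym t)) λ ()
... | inj₂ p | inj₁ q | inj₁ t = contradiction (trans q (sym t)) λ ()
... | inj₂ p | inj₁ q | inj₂ t = contradiction (trans p (sym t)) λ ()

module _ {G : Graph} (covered : MatchingCovered G) where

  private
    connected = proj₁ covered
    n≥4       = proj₁ (proj₂ covered)
    perfect   = proj₂ (proj₂ covered)

  covering-weight : ∀ e → ∃ λ w → Matched G w × 1 ≤ w e
  covering-weight e with perfect e
  ... | M , pm , e∈M =
    matching-weight G M , perfect⇒matched G pm , ≤-reflexive (sym (⟦⟧-yes (e ∈? M) e∈M))

  other-end : ∀ {v e} → Incident G v e →
              ∃ λ w → Incident G w e × (∀ {x} → Incident G x e → x ≡ v ⊎ x ≡ w)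
  other-end (inj₁ refl) = _ , inj₂ refl , id
  other-end (inj₂ refl) = _ , inj₁ refl , swap

  -- If `e` were the only edge at `v`, every perfect matching would contain it, so its other end `w`
  -- would have no other edge either, and `v` and `w` would form a component of a graph on at least
  -- four vertices.
  other-edge : ∀ {v e} → Incident G v e → ∃ λ f → f ≢ e × Incident G v f
  other-edge {v} {e} ve with any? (λ f → ¬? (f ≟ e) ×-dec incident? G v f) | other-end ve
  ... | yes found | _ = found
  ... | no none   | w , we , ends-e = contradiction
    (λ x → star-closed {G} (λ x → x ≡ v ⊎ x ≡ w) step (connected v x) (inj₁ refl)) (not-two n≥4 v w)
    where
    only-v : ∀ {f} → Incident G v f → f ≡ e
    only-v {f} vf with f ≟ e
    ... | yes f≡e = f≡e
    ... | no f≢e  = contradiction (f , f≢e , vf) none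

    only-w : ∀ {f} → Incident G w f → f ≡ e
    only-w {f} wf with covering-weight f
    ... | μ , matched , 1≤μf with matched-cover G μ matched v
    ...   | k , 1≤μk , vk =
      matched-unique G μ matched 1≤μf (subst (λ k → 1 ≤ μ k) (only-v vk) 1≤μk) wf we

    step : ∀ {x y} → Adjacent G x y → x ≡ v ⊎ x ≡ w → y ≡ v ⊎ y ≡ w
    step (_ , f , xf , yf) (inj₁ refl) = ends-e (subst (Incident G _) (only-v xf) yf)
    step (_ , f , xf , yf) (inj₂ refl) = ends-e (subst (Incident G _) (only-w xf) yf)

  incident-edge : ∀ v → ∃ λ e → Incident G v e
  incident-edge v with any? (incident? G v)
  ... | yes found = found
  ... | no none   = contradiction
    (λ x → inj₁ (star-closed {G} (_≡ v) step (connected v x) refl)) (not-two n≥4 v v)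
    where
    step : ∀ {x y} → Adjacent G x y → x ≡ v → y ≡ v
    step (_ , f , xf , _) refl = contradiction (f , xf) none

  degree≥2 : ∀ v → 2 ≤ degree G v
  degree≥2 v with incident-edge v
  ... | e , ve with other-edge ve
  ...   | f , f≢e , vf = begin
    2                   ≡⟨ sym (cong₂ _+_ (⟦⟧-yes (incident? G v f) vf) (⟦⟧-yes (incident? G v e) ve)) ⟩
    inc G v f + inc G v e ≤⟨ terms≤sum (inc G v) f≢e ⟩
    sum (inc G v)         ≡⟨ sym (degree≡sum G v) ⟩
    degree G v          ∎
    where open ≤-Reasoning

  third-edge : ∀ {v} → degree G v ≢ 2 → ∀ e f → ∃ λ k → Incident G v k × k ≢ e × k ≢ f
  third-edge {v} deg≢2 e f with any? (λ k → incident? G v k ×-dec ¬? (k ≟ e) ×-dec ¬? (k ≟ f))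
  ... | yes found = found
  ... | no none   = contradiction (≤-antisym degree≤2 (degree≥2 v)) deg≢2
    where
    open ≤-Reasoning
    only : ∀ k → Incident G v k → k ≡ e ⊎ k ≡ f
    only k vk with k ≟ e | k ≟ f
    ... | yes k≡e | _       = inj₁ k≡e
    ... | no _    | yes k≡f = inj₂ k≡f
    ... | no k≢e  | no k≢f  = contradiction (k , vk , k≢e , k≢f) none

    degree≤2 : degree G v ≤ 2
    degree≤2 = begin
      degree G v     ≡⟨ degree≡sum G v ⟩
      sum (inc G v)  ≤⟨ sum-mono-≤ (inc G v) _ (λ k → ⟦⟧-⊎ (incident? G v k) (k ≟ e) (k ≟ f) (only k)) ⟩
      sum (λ k → ⟦ k ≟ e ⟧ + ⟦ k ≟ f ⟧)       ≡⟨ ∑-distrib-+ (λ k → ⟦ k ≟ e ⟧) _ ⟩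
      sum (λ k → ⟦ k ≟ e ⟧) + sum (λ k → ⟦ k ≟ f ⟧) ≡⟨ cong₂ _+_ (sum-indicator e) (sum-indicator f) ⟩
      2              ∎

-- Bipartite graphs, directed from one colour class to the other

module Bipartition {G : Graph} (χ : Vertex G → Bool)
                   (proper : ∀ e → χ (proj₁ (ends G e)) ≢ χ (proj₂ (ends G e))) where

  private
    orient : ∀ e → ∃ λ a → ∃ λ b → χ a ≡ true × χ b ≡ false ×
             (∀ {v} → Incident G v e → v ≡ a ⊎ v ≡ b) × Incident G a e × Incident G b e
    orient e with χ (proj₁ (ends G e)) in eq₁ | χ (proj₂ (ends G e)) in eq₂
    ... | true  | true  = contradiction (trans eq₁ (sym eq₂)) (proper e)
    ... | true  | false = _ , _ , eq₁ , eq₂ , id , inj₁ refl , inj₂ refl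
    ... | false | true  = _ , _ , eq₂ , eq₁ , swap , inj₂ refl , inj₁ refl
    ... | false | false = contradiction (trans eq₁ (sym eq₂)) (proper e)

  tail : Edge G → Vertex G
  tail e = proj₁ (orient e)

  head : Edge G → Vertex G
  head e = proj₁ (proj₂ (orient e))

  χ-tail : ∀ e → χ (tail e) ≡ true
  χ-tail e = proj₁ (proj₂ (proj₂ (orient e)))

  χ-head : ∀ e → χ (head e) ≡ false
  χ-head e = proj₁ (proj₂ (proj₂ (proj₂ (orient e))))

  tail-or-head : ∀ {v e} → Incident G v e → v ≡ tail e ⊎ v ≡ head e
  tail-or-head {v} {e} = proj₁ (proj₂ (proj₂ (proj₂ (proj₂ (orient e)))))

  tail-incident : ∀ e → Incident G (tail e) e
  tail-incident e = proj₁ (proj₂ (proj₂ (proj₂ (proj₂ (proj₂ (orient e))))))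

  head-incident : ∀ e → Incident G (head e) e
  head-incident e = proj₂ (proj₂ (proj₂ (proj₂ (proj₂ (proj₂ (orient e))))))

  tail≢head : ∀ e f → tail e ≢ head f
  tail≢head e f eq = contradiction (trans (sym (χ-tail e)) (trans (cong χ eq) (χ-head f))) λ ()

  is-tail : ∀ {v e} → χ v ≡ true → Incident G v e → tail e ≡ v
  is-tail {e = e} χv ve with tail-or-head ve
  ... | inj₁ v≡t  = sym v≡t
  ... | inj₂ refl = contradiction (trans (sym χv) (χ-head e)) λ ()

  is-head : ∀ {v e} → χ v ≡ false → Incident G v e → head e ≡ v
  is-head {e = e} χv ve with tail-or-head ve
  ... | inj₁ refl = contradiction (trans (sym χv) (χ-tail e)) λ ()
  ... | inj₂ v≡h  = sym v≡h

  inc-split : ∀ v e → inc G v e ≡ ⟦ v ≟ tail e ⟧ + ⟦ v ≟ head e ⟧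
  inc-split v e = ⟦⟧-disjoint-⊎ (incident? G v e) (v ≟ tail e) (v ≟ head e) tail-or-head
    (λ { refl → tail-incident e }) (λ { refl → head-incident e })
    (λ v≡t v≡h → tail≢head e e (trans (sym v≡t) v≡h))

  -- Double counting of weighted incidences: each edge sees `c` at its two ends.
  load-sum : ∀ w (c : Vertex G → ℕ) →
    sum (λ v → c v * load G w v) ≡ sum (λ e → w e * (c (tail e) + c (head e)))
  load-sum w c = begin
    sum (λ v → c v * load G w v)
      ≡⟨ sum-cong-≗ (λ v → *-distribˡ-sum (c v) (λ e → w e * inc G v e)) ⟩
    sum (λ v → sum (λ e → c v * (w e * inc G v e)))
      ≡⟨ ∑-comm (λ v e → c v * (w e * inc G v e)) ⟩
    sum (λ e → sum (λ v → c v * (w e * inc G v e)))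
      ≡⟨ sum-cong-≗ (λ e → trans (sum-cong-≗ (λ v → rearrange (c v) (w e) (inc G v e)))
           (sym (*-distribˡ-sum (w e) (λ v → inc G v e * c v)))) ⟩
    sum (λ e → w e * sum (λ v → inc G v e * c v))
      ≡⟨ sum-cong-≗ (λ e → cong (w e *_) (ends-sum e)) ⟩
    sum (λ e → w e * (c (tail e) + c (head e))) ∎
    where
    open ≡-Reasoning
    rearrange : ∀ x y z → x * (y * z) ≡ y * (z * x)
    rearrange x y z = trans (*-comm x (y * z)) (*-assoc y z x)

    ends-sum : ∀ e → sum (λ v → inc G v e * c v) ≡ c (tail e) + c (head e)
    ends-sum e = begin
      sum (λ v → inc G v e * c v)
        ≡⟨ sum-cong-≗ (λ v → trans (cong (_* c v) (inc-split v e))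
             (*-distribʳ-+ (c v) ⟦ v ≟ tail e ⟧ ⟦ v ≟ head e ⟧)) ⟩
      sum (λ v → ⟦ v ≟ tail e ⟧ * c v + ⟦ v ≟ head e ⟧ * c v)
        ≡⟨ ∑-distrib-+ (λ v → ⟦ v ≟ tail e ⟧ * c v) _ ⟩
      sum (λ v → ⟦ v ≟ tail e ⟧ * c v) + sum (λ v → ⟦ v ≟ head e ⟧ * c v)
        ≡⟨ cong₂ _+_ (sum-select (tail e) c) (sum-select (head e) c) ⟩
      c (tail e) + c (head e) ∎

  A? : Decidable (λ v → χ v ≡ true)
  A? v = χ v Bool.≟ true

  B? : Decidable (λ v → χ v ≡ false)
  B? v = χ v Bool.≟ false

  load-sum-tail : ∀ w {P : Pred (Vertex G) 0ℓ} (P? : Decidable P) →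
    sum (λ v → ⟦ A? v ×-dec P? v ⟧ * load G w v) ≡ sum (λ e → w e * ⟦ P? (tail e) ⟧)
  load-sum-tail w P? = trans (load-sum w (λ v → ⟦ A? v ×-dec P? v ⟧)) (sum-cong-≗ λ e → cong (w e *_)
    (trans (cong₂ _+_ (⟦⟧-cong (A? (tail e) ×-dec P? (tail e)) (P? (tail e)) proj₂ (χ-tail e ,_))
                      (⟦⟧-no (A? (head e) ×-dec P? (head e))
                         λ { (χ≡true , _) → contradiction (trans (sym χ≡true) (χ-head e)) λ () }))
           (+-identityʳ ⟦ P? (tail e) ⟧)))

  load-sum-head : ∀ w {Q : Pred (Vertex G) 0ℓ} (Q? : Decidable Q) →
    sum (λ v → ⟦ B? v ×-dec Q? v ⟧ * load G w v) ≡ sum (λ e → w e * ⟦ Q? (head e) ⟧)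
  load-sum-head w Q? = trans (load-sum w (λ v → ⟦ B? v ×-dec Q? v ⟧)) (sum-cong-≗ λ e → cong (w e *_)
    (cong₂ _+_ (⟦⟧-no (B? (tail e) ×-dec Q? (tail e))
                  λ { (χ≡false , _) → contradiction (trans (sym (χ-tail e)) χ≡false) λ () })
               (⟦⟧-cong (B? (head e) ×-dec Q? (head e)) (Q? (head e)) proj₂ (χ-head e ,_))))

  -- The value does not depend on `w`, which is what allows `balance` to compare two perfect
  -- matchings.
  matched-sum-tail : ∀ w → Matched G w → ∀ {P : Pred (Vertex G) 0ℓ} (P? : Decidable P) →
    sum (λ e → w e * ⟦ P? (tail e) ⟧) ≡ # (λ v → A? v ×-dec P? v)
  matched-sum-tail w matched P? = sym (trans
    (sum-cong-≗ (λ v → sym (trans (cong (⟦ A? v ×-dec P? v ⟧ *_) (matched v)) (*-identityʳ _))))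
    (load-sum-tail w P?))

  matched-sum-head : ∀ w → Matched G w → ∀ {Q : Pred (Vertex G) 0ℓ} (Q? : Decidable Q) →
    sum (λ e → w e * ⟦ Q? (head e) ⟧) ≡ # (λ v → B? v ×-dec Q? v)
  matched-sum-head w matched Q? = sym (trans
    (sum-cong-≗ (λ v → sym (trans (cong (⟦ B? v ×-dec Q? v ⟧ *_) (matched v)) (*-identityʳ _))))
    (load-sum-head w Q?))

  weighted-mono : ∀ x {A B : Set} (a? : Dec A) (b? : Dec B) → (1 ≤ x → A → B) → x * ⟦ a? ⟧ ≤ x * ⟦ b? ⟧
  weighted-mono zero    a? b? f = z≤n
  weighted-mono (suc x) a? b? f = *-monoʳ-≤ (suc x) (⟦⟧-mono a? b? (f (s≤s z≤n)))

  -- A region respected by one perfect matching has as many tails as heads,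
  -- so a perfect matching that does not leave it does not enter it either.
  balance : ∀ (Z : Region (n G)) (let open Region Z) w₀ w → Matched G w₀ → Matched G w →
    (∀ {e} → 1 ≤ w₀ e → P (tail e) → Q (head e)) → (∀ {e} → 1 ≤ w₀ e → Q (head e) → P (tail e)) →
    (∀ {e} → 1 ≤ w e → P (tail e) → Q (head e)) → ∀ {e} → 1 ≤ w e → Q (head e) → P (tail e)
  balance Z w₀ w matched₀ matched fwd₀ bwd₀ fwd {e} 1≤we Qe =
    ⟦⟧-positive (P? (tail e)) (1≤*ʳ (w e) (begin
      1                      ≤⟨ *-mono-≤ 1≤we (≤-reflexive (sym (⟦⟧-yes (Q? (head e)) Qe))) ⟩
      w e * ⟦ Q? (head e) ⟧  ≤⟨ sum-≤-tight (λ e → w e * ⟦ P? (tail e) ⟧) (λ e → w e * ⟦ Q? (head e) ⟧)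
                                 (λ e → weighted-mono (w e) (P? (tail e)) (Q? (head e)) fwd) total e ⟩
      w e * ⟦ P? (tail e) ⟧  ∎))
    where
    open Region Z
    open ≤-Reasoning
    total : sum (λ e → w e * ⟦ Q? (head e) ⟧) ≤ sum (λ e → w e * ⟦ P? (tail e) ⟧)
    total = begin
      sum (λ e → w e * ⟦ Q? (head e) ⟧)   ≡⟨ matched-sum-head w matched Q? ⟩
      # (λ v → B? v ×-dec Q? v)           ≡⟨ sym (matched-sum-head w₀ matched₀ Q?) ⟩
      sum (λ e → w₀ e * ⟦ Q? (head e) ⟧)  ≤⟨ sum-mono-≤ _ (λ e → w₀ e * ⟦ P? (tail e) ⟧)
                                               (λ e → weighted-mono (w₀ e) (Q? (head e)) (P? (tail e)) bwd₀) ⟩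
      sum (λ e → w₀ e * ⟦ P? (tail e) ⟧)  ≡⟨ matched-sum-tail w₀ matched₀ P? ⟩
      # (λ v → A? v ×-dec P? v)           ≡⟨ sym (matched-sum-tail w matched P?) ⟩
      sum (λ e → w e * ⟦ P? (tail e) ⟧)   ∎

  module _ (covered : MatchingCovered G) where

    private
      connected = proj₁ covered
      n≥4       = proj₁ (proj₂ covered)

    -- Every edge lies in some perfect matching, and by `balance` this matching does not enter the
    -- region. Hence no edge enters or leaves it, and connectivity spreads membership to all
    -- vertices.
    strongly-connected : ∀ (Z : Region (n G)) (let open Region Z) w₀ → Matched G w₀ →
      (∀ e → P (tail e) → Q (head e)) → (∀ {e} → 1 ≤ w₀ e → Q (head e) → P (tail e)) →
      ∀ {r} → χ r ≡ true → ∀ h → (P (tail h) → P r) × (P r → Q (head h))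
    strongly-connected Z w₀ matched₀ fwd bwd₀ {r} χr h =
      (λ Ph → on-A χr (spread (inj₁ (χ-tail h , Ph)))) ,
      (λ Pr → on-B (χ-head h) (spread (inj₁ (χr , Pr))))
      where
      open Region Z
      Both : Pred (Vertex G) 0ℓ
      Both v = (χ v ≡ true × P v) ⊎ (χ v ≡ false × Q v)

      on-A : ∀ {v} → χ v ≡ true → Both v → P v
      on-A _  (inj₁ (_ , Pv))  = Pv
      on-A χv (inj₂ (χv' , _)) = contradiction (trans (sym χv) χv') λ ()

      on-B : ∀ {v} → χ v ≡ false → Both v → Q v
      on-B χv (inj₁ (χv' , _)) = contradiction (trans (sym χv) χv') λ ()
      on-B _  (inj₂ (_ , Qv))  = Qv

      bwd : ∀ e → Q (head e) → P (tail e)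
      bwd e with covering-weight {G} covered e
      ... | w , matched , 1≤we = balance Z w₀ w matched₀ matched (λ _ → fwd _) bwd₀ (λ _ → fwd _) 1≤we

      step : ∀ {u v} → Adjacent G u v → Both u → Both v
      step (u≢v , e , ue , ve) Bu with tail-or-head ue | tail-or-head ve
      ... | inj₁ refl | inj₁ refl = contradiction refl u≢v
      ... | inj₁ refl | inj₂ refl = inj₂ (χ-head e , fwd e (on-A (χ-tail e) Bu))
      ... | inj₂ refl | inj₁ refl = inj₁ (χ-tail e , bwd e (on-B (χ-head e) Bu))
      ... | inj₂ refl | inj₂ refl = contradiction refl u≢v

      spread : ∀ {u v} → Both u → Both v
      spread {u} {v} = star-closed {G} Both step (connected u v)

    -- Alternating paths, and separation by a single edge

    module Exchange (h : Edge G) (w₀ : Edge G → ℕ) (matched₀ : Matched G w₀) (w₀h≡0 : w₀ h ≡ 0) where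

      matched≢h : ∀ {e} → 1 ≤ w₀ e → e ≢ h
      matched≢h 1≤w₀e refl = contradiction (≤-trans 1≤w₀e (≤-reflexive w₀h≡0)) λ ()

      -- One step of a w₀-alternating path: leave x along f ≠ h and return along
      -- the edge f' of w₀.
      Step : Rel (Vertex G) 0ℓ
      Step x y = ∃ λ f → f ≢ h × tail f ≡ x × ∃ λ f' → head f' ≡ head f × 1 ≤ w₀ f' × tail f' ≡ y

      step? : ∀ x y → Dec (Step x y)
      step? x y = any? λ f → ¬? (f ≟ h) ×-dec (tail f ≟ x) ×-dec
        any? λ f' → (head f' ≟ head f) ×-dec (1 ≤? w₀ f') ×-dec (tail f' ≟ y)

      -- Adds `f` and removes `f'`; the truncated subtraction is exact once `f'` has positive
      -- weight.
      exchange : (w : Edge G → ℕ) → Edge G → Edge G → Edge G → ℕ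
      exchange w f f' e = (w e + ⟦ e ≟ f ⟧) ∸ ⟦ e ≟ f' ⟧

      exchange-eq : ∀ w f {f'} → 1 ≤ w f' → ∀ e → exchange w f f' e + ⟦ e ≟ f' ⟧ ≡ w e + ⟦ e ≟ f ⟧
      exchange-eq w f {f'} 1≤wf' e with e ≟ f'
      ... | yes refl = m∸n+n≡m (≤-trans 1≤wf' (m≤m+n (w e) _))
      ... | no _     = +-identityʳ _

      load-exchange : ∀ w f {f'} → 1 ≤ w f' → ∀ v →
        load G (exchange w f f') v + inc G v f' ≡ load G w v + inc G v f
      load-exchange w f {f'} 1≤wf' v = begin
        load G (exchange w f f') v + inc G v f'
          ≡⟨ cong (load G (exchange w f f') v +_) (sym (load-edge G f' v)) ⟩
        load G (exchange w f f') v + load G (λ e → ⟦ e ≟ f' ⟧) v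
          ≡⟨ sym (load-+ G (exchange w f f') (λ e → ⟦ e ≟ f' ⟧) v) ⟩
        load G (λ e → exchange w f f' e + ⟦ e ≟ f' ⟧) v
          ≡⟨ sum-cong-≗ (λ e → cong (_* inc G v e) (exchange-eq w f 1≤wf' e)) ⟩
        load G (λ e → w e + ⟦ e ≟ f ⟧) v
          ≡⟨ load-+ G w (λ e → ⟦ e ≟ f ⟧) v ⟩
        load G w v + load G (λ e → ⟦ e ≟ f ⟧) v
          ≡⟨ cong (load G w v +_) (load-edge G f v) ⟩
        load G w v + inc G v f ∎
        where open ≡-Reasoning

      -- w misses exactly the vertices x and y.
      NearMatched : (Edge G → ℕ) → Vertex G → Vertex G → Set
      NearMatched w x y = ∀ v → load G w v + (⟦ v ≟ x ⟧ + ⟦ v ≟ y ⟧) ≡ 1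

      module _ {g : Edge G} (g≢h : g ≢ h) (R : Reach Step (tail g)) where
        open Reach R

        -- Ranks decrease along the path, so no later edge of the path has been
        -- exchanged yet.
        augment : ∀ k {x} w → rank x < k → W x → NearMatched w x (head g) → w h ≡ 0 →
          (∀ {f} → 1 ≤ w₀ f → rank (tail f) < rank x → 1 ≤ w f) →
          ∃ λ w' → Matched G w' × 1 ≤ w' g × w' h ≡ 0
        augment (suc k) {x} w x<k Wx near wh≡0 intact with descend Wx
        ... | inj₁ refl = (λ e → w e + ⟦ e ≟ g ⟧) , matched ,
          ≤-trans (≤-reflexive (sym (⟦⟧-yes (g ≟ g) refl))) (m≤n+m _ (w g)) ,
          cong₂ _+_ wh≡0 (⟦⟧-no (h ≟ g) (g≢h ∘ sym))
          where
          matched : Matched G (λ e → w e + ⟦ e ≟ g ⟧)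
          matched v = begin
            load G (λ e → w e + ⟦ e ≟ g ⟧) v               ≡⟨ load-+ G w (λ e → ⟦ e ≟ g ⟧) v ⟩
            load G w v + load G (λ e → ⟦ e ≟ g ⟧) v        ≡⟨ cong (load G w v +_) (load-edge G g v) ⟩
            load G w v + inc G v g                         ≡⟨ cong (load G w v +_) (inc-split v g) ⟩
            load G w v + (⟦ v ≟ tail g ⟧ + ⟦ v ≟ head g ⟧) ≡⟨ near v ⟩
            1                                              ∎
            where open ≡-Reasoning
        ... | inj₂ (y , (f , f≢h , refl , f' , hf' , 1≤w₀f' , refl) , Wy , y<x) =
          augment k w' (<-≤-trans y<x (≤-pred x<k)) Wy near' w'h≡0 intact'
          where
          w' = exchange w f f'
          1≤wf' = intact 1≤w₀f' y<x

          w'h≡0 : w' h ≡ 0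
          w'h≡0 = cong₂ _∸_ (cong₂ _+_ wh≡0 (⟦⟧-no (h ≟ f) (f≢h ∘ sym)))
                            (⟦⟧-no (h ≟ f') (matched≢h 1≤w₀f' ∘ sym))

          intact' : ∀ {k} → 1 ≤ w₀ k → rank (tail k) < rank (tail f') → 1 ≤ w' k
          intact' {k} 1≤w₀k k<y with exchange-eq w f 1≤wf' k
          ... | eq = begin
            1                      ≤⟨ intact 1≤w₀k (<-trans k<y y<x) ⟩
            w k                    ≤⟨ m≤m+n (w k) _ ⟩
            w k + ⟦ k ≟ f ⟧        ≡⟨ sym eq ⟩
            w' k + ⟦ k ≟ f' ⟧      ≡⟨ cong (w' k +_) (⟦⟧-no (k ≟ f') λ { refl → <-irrefl refl k<y }) ⟩
            w' k + 0               ≡⟨ +-identityʳ (w' k) ⟩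
            w' k                   ∎
            where open ≤-Reasoning

          near' : NearMatched w' (tail f') (head g)
          -- `f` and `f'` share their head, so adding its indicator to both sides completes the two
          -- tails to whole edges, whose loads `load-exchange` relates.
          near' v = +-cancelʳ-≡ ⟦ v ≟ head f ⟧ _ _ (begin
            load G w' v + (⟦ v ≟ tail f' ⟧ + c) + ⟦ v ≟ head f ⟧
              ≡⟨ cong (λ b → load G w' v + (⟦ v ≟ tail f' ⟧ + c) + ⟦ v ≟ b ⟧) (sym hf') ⟩
            load G w' v + (⟦ v ≟ tail f' ⟧ + c) + ⟦ v ≟ head f' ⟧
              ≡⟨ shuffle (load G w' v) ⟦ v ≟ tail f' ⟧ c ⟦ v ≟ head f' ⟧ ⟩
            load G w' v + (⟦ v ≟ tail f' ⟧ + ⟦ v ≟ head f' ⟧) + c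
              ≡⟨ cong (λ x → load G w' v + x + c) (sym (inc-split v f')) ⟩
            load G w' v + inc G v f' + c
              ≡⟨ cong (_+ c) (load-exchange w f 1≤wf' v) ⟩
            load G w v + inc G v f + c
              ≡⟨ cong (λ x → load G w v + x + c) (inc-split v f) ⟩
            load G w v + (⟦ v ≟ tail f ⟧ + ⟦ v ≟ head f ⟧) + c
              ≡⟨ sym (shuffle (load G w v) ⟦ v ≟ tail f ⟧ c ⟦ v ≟ head f ⟧) ⟩
            load G w v + (⟦ v ≟ tail f ⟧ + c) + ⟦ v ≟ head f ⟧
              ≡⟨ cong (_+ ⟦ v ≟ head f ⟧) (near v) ⟩
            1 + ⟦ v ≟ head f ⟧ ∎)
            where
            open ≡-Reasoning
            c = ⟦ v ≟ head g ⟧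
            shuffle : ∀ l t c b → l + (t + c) + b ≡ l + (t + b) + c
            shuffle = solve 4 (λ l t c b → l :+ (t :+ c) :+ b := l :+ (t :+ b) :+ c) refl
              where open +-*-Solver

        -- Removing `f₀` leaves its tail and the head of `g` unmatched. The path from that tail to
        -- the tail of `g`, closed by `g`, restores a perfect matching.
        augment-from : ∀ {f₀} → 1 ≤ w₀ f₀ → head f₀ ≡ head g → W (tail f₀) →
                       ∃ λ w' → Matched G w' × 1 ≤ w' g × w' h ≡ 0
        augment-from {f₀} 1≤w₀f₀ hf₀ Wx =
          augment _ w ≤-refl Wx near (trans (cong (_∸ ⟦ h ≟ f₀ ⟧) w₀h≡0) (0∸n≡0 ⟦ h ≟ f₀ ⟧)) intact
          where
          w : Edge G → ℕ
          w e = w₀ e ∸ ⟦ e ≟ f₀ ⟧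

          w-eq : ∀ e → w e + ⟦ e ≟ f₀ ⟧ ≡ w₀ e
          w-eq e with e ≟ f₀
          ... | yes refl = m∸n+n≡m 1≤w₀f₀
          ... | no _     = +-identityʳ _

          intact : ∀ {f} → 1 ≤ w₀ f → rank (tail f) < rank (tail f₀) → 1 ≤ w f
          intact {f} 1≤w₀f f<f₀ = ≤-trans 1≤w₀f (≤-reflexive (sym
            (cong (w₀ f ∸_) (⟦⟧-no (f ≟ f₀) λ { refl → <-irrefl refl f<f₀ }))))

          near : NearMatched w (tail f₀) (head g)
          near v = begin
            load G w v + (⟦ v ≟ tail f₀ ⟧ + ⟦ v ≟ head g ⟧)
              ≡⟨ cong (λ b → load G w v + (⟦ v ≟ tail f₀ ⟧ + ⟦ v ≟ b ⟧)) (sym hf₀) ⟩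
            load G w v + (⟦ v ≟ tail f₀ ⟧ + ⟦ v ≟ head f₀ ⟧)
              ≡⟨ cong (load G w v +_) (sym (inc-split v f₀)) ⟩
            load G w v + inc G v f₀
              ≡⟨ cong (load G w v +_) (sym (load-edge G f₀ v)) ⟩
            load G w v + load G (λ e → ⟦ e ≟ f₀ ⟧) v
              ≡⟨ sym (load-+ G w (λ e → ⟦ e ≟ f₀ ⟧) v) ⟩
            load G (λ e → w e + ⟦ e ≟ f₀ ⟧) v
              ≡⟨ sum-cong-≗ (λ e → cong (_* inc G v e) (w-eq e)) ⟩
            load G w₀ v
              ≡⟨ matched₀ v ⟩
            1 ∎
            where open ≡-Reasoning

      -- A cut in which entering is excluded for `w₀` alone; `balance` later extends this to all
      -- matchings that avoid `h`.
      record Separation : Set₁ where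
        field
          region   : Region (n G)
        open Region region public
        field
          tail∈    : P (tail h)
          head∉    : ¬ Q (head h)
          forward  : ∀ {g} → g ≢ h → P (tail g) → Q (head g)
          backward : ∀ {g} → 1 ≤ w₀ g → Q (head g) → P (tail g)

      mate : ∀ e → ∃ λ f → 1 ≤ w₀ f × head f ≡ head e
      mate e with matched-cover G w₀ matched₀ (head e)
      ... | f , 1≤w₀f , inc-f = f , 1≤w₀f , is-head (χ-head e) inc-f

      module _ {u} (R : Reach Step u) where
        open Reach R

        -- A head is placed with its partner under `w₀`, so edges of `w₀` never cross the boundary.
        unreached : Region (n G)
        unreached = record
          { P  = λ v → ¬ W v ; P? = λ v → ¬? (W? v)
          ; Q  = λ v → ∃ λ f → 1 ≤ w₀ f × head f ≡ v × ¬ W (tail f)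
          ; Q? = λ v → any? λ f → (1 ≤? w₀ f) ×-dec (head f ≟ v) ×-dec ¬? (W? (tail f)) }
        open Region unreached

        unreached-forward : ∀ {g} → g ≢ h → P (tail g) → Q (head g)
        unreached-forward {g} g≢h ¬Wg with mate g
        ... | f , 1≤w₀f , hf =
          f , 1≤w₀f , hf , λ Wf → ¬Wg (closed (g , g≢h , refl , f , hf , 1≤w₀f , refl) Wf)

        unreached-backward : ∀ {g} → 1 ≤ w₀ g → Q (head g) → P (tail g)
        unreached-backward {g} 1≤w₀g (f , 1≤w₀f , hf , ¬Wf) =
          subst (λ f → ¬ W (tail f))
            (matched-unique G w₀ matched₀ 1≤w₀f 1≤w₀g
              (subst (λ v → Incident G v f) hf (head-incident f)) (head-incident g)) ¬Wf

        separation : P (tail h) → ¬ Q (head h) → Separation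
        separation Ph ¬Qh = record { region = unreached ; tail∈ = Ph ; head∉ = ¬Qh
                                   ; forward = unreached-forward ; backward = unreached-backward }

        reached-path : ∀ k {x} → rank x < k → W x → Star (AdjacentAvoiding G h) x u
        reached-path (suc k) x<k Wx with descend Wx
        ... | inj₁ refl = nil
        ... | inj₂ (y , (f , f≢h , refl , f' , hf' , 1≤w₀f' , refl) , Wy , y<x) =
          (tail≢head f f , f , f≢h , tail-incident f , head-incident f) ◅
          (tail≢head f' f ∘ sym , f' , matched≢h 1≤w₀f' ,
            subst (λ v → Incident G v f') hf' (head-incident f') , tail-incident f') ◅
          reached-path k (<-≤-trans y<x (≤-pred x<k)) Wy

      -- If no alternating path closes up through g, then the vertices from which the
      -- tail of g cannot be reached are separated by h alone.
      avoidable-or-separated : ∀ g → (g ≢ h → ∃ λ w → Matched G w × 1 ≤ w g × w h ≡ 0) ⊎ Separation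
      avoidable-or-separated g with 1 ≤? w₀ g | g ≟ h
      ... | yes 1≤w₀g | _ = inj₁ λ _ → w₀ , matched₀ , 1≤w₀g , w₀h≡0
      ... | no _ | yes g≡h = inj₁ λ g≢h → contradiction g≡h g≢h
      ... | no _ | no g≢h with reach step? (tail g) | mate g
      ...   | R | f₀ , 1≤w₀f₀ , hf₀ with Reach.W? R (tail f₀)
      ...     | yes Wf₀ = inj₁ λ _ → augment-from g≢h R 1≤w₀f₀ hf₀ Wf₀
      ...     | no ¬Wf₀ with P? (tail h) ×-dec ¬? (Q? (head h))
        where open Region (unreached R)
      ...       | yes (Ph , ¬Qh) = inj₂ (separation R Ph ¬Qh)
      -- If `h` does not leave the region either, no edge does. As it contains the tail of `f₀`, it
      -- would contain the tail of `g`, which is reached.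
      ...       | no ¬leaves = contradiction (Reach.target R)
        (proj₁ (strongly-connected (unreached R) w₀ matched₀ fwd (unreached-backward R) (χ-tail g) f₀) ¬Wf₀)
        where
        open Region (unreached R)
        fwd : ∀ e → P (tail e) → Q (head e)
        fwd e Pe with e ≟ h | Q? (head e)
        ... | no e≢h   | _      = unreached-forward R e≢h Pe
        ... | yes refl | yes Qe = Qe
        ... | yes refl | no ¬Qe = contradiction (Pe , ¬Qe) ¬leaves

      -- Let `f` be the edge of `w₀` at the head of `h`. If the tail of `h` reaches the tail of `f`,
      -- that path followed by `f` is a detour around `h`; otherwise the unreached vertices are
      -- separated by `h`.
      connected-or-separated : (∀ u v → Star (AdjacentAvoiding G h) u v) ⊎ Separation
      connected-or-separated with mate h
      ... | f , 1≤w₀f , hf with reach step? (tail f)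
      ...   | R with Reach.W? R (tail h)
      ...     | no ¬Wh = inj₂ (separation R ¬Wh λ Qh →
        unreached-backward R 1≤w₀f (subst (Region.Q (unreached R)) (sym hf) Qh) (Reach.target R))
      ...     | yes Wh = inj₁ λ u v → kleisliStar id detour (connected u v)
        where
        sym-step : ∀ {u v} → AdjacentAvoiding G h u v → AdjacentAvoiding G h v u
        sym-step (u≢v , e , e≢h , ue , ve) = u≢v ∘ sym , e , e≢h , ve , ue

        tail⟶head : Star (AdjacentAvoiding G h) (tail h) (head h)
        tail⟶head = reached-path R _ ≤-refl Wh ◅◅
          (tail≢head f h , f , matched≢h 1≤w₀f , tail-incident f ,
            subst (λ v → Incident G v f) hf (head-incident f)) ◅ nil

        detour : ∀ {u v} → Adjacent G u v → Star (AdjacentAvoiding G h) u v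
        detour (u≢v , e , ue , ve) with e ≟ h
        ... | no e≢h = (u≢v , e , e≢h , ue , ve) ◅ nil
        ... | yes refl with tail-or-head ue | tail-or-head ve
        ...   | inj₁ refl | inj₁ refl = contradiction refl u≢v
        ...   | inj₁ refl | inj₂ refl = tail⟶head
        ...   | inj₂ refl | inj₁ refl = reverse sym-step tail⟶head
        ...   | inj₂ refl | inj₂ refl = contradiction refl u≢v

      separated : ¬ MatchingCovered (delete G h) → Separation
      separated ¬mc with connected-or-separated | all-or avoidable-or-separated
      ... | inj₂ s    | _          = s
      ... | inj₁ _    | inj₂ s     = s
      ... | inj₁ conn | inj₁ avoid = contradiction (matching-covered-delete G h conn n≥4 avoid) ¬mc

-- The bound on the number of vertices of degree two

module MinimalBound {G : Graph} (covered : MatchingCovered G)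
                    (minimal : ∀ e → ¬ MatchingCovered (delete G e))
                    (χ : Vertex G → Bool)
                    (proper : ∀ e → χ (proj₁ (ends G e)) ≢ χ (proj₂ (ends G e))) where
  open Bipartition {G} χ proper

  Matching : Set
  Matching = ∃ λ w → Matched G w

  _∈M_ : Edge G → Matching → Set
  e ∈M (w , _) = 1 ≤ w e

  -- A perfect matching through another edge at the tail of `h` cannot contain `h`.
  avoiding : ∀ h → ∃ λ w → Matched G w × w h ≡ 0
  avoiding h with other-edge {G} covered (tail-incident h)
  ... | f , f≢h , inc-f with covering-weight {G} covered f
  ...   | w , matched , 1≤wf = w , matched , n<1⇒n≡0 (≰⇒> λ 1≤wh →
    f≢h (matched-unique G w matched 1≤wf 1≤wh inc-f (tail-incident h)))

  A₂ : Pred (Vertex G) 0ℓ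
  A₂ v = χ v ≡ true × degree G v ≡ 2

  A₂? : Decidable A₂
  A₂? v = A? v ×-dec (degree G v ℕ.≟ 2)

  module _ {r} (χr : χ r ≡ true) where

    shape : Shape {m G} {n G} _∈M_
    shape = record
      { ε    = λ _ → ⊤
      ; ε?   = λ _ → yes tt
      ; β    = λ v → χ v ≡ false
      ; β?   = B?
      ; κ    = λ v → χ v ≡ true × degree G v ≢ 2 × v ≢ r
      ; κ?   = λ v → A? v ×-dec ¬? (degree G v ℕ.≟ 2) ×-dec ¬? (v ≟ r)
      ; tail = tail
      ; head = head
      }

    cut : ∀ h → CutOf _∈M_ shape h
    cut h with avoiding h
    ... | w₀ , matched₀ , w₀h≡0 = record
      { region   = region
      ; tail∈    = tail∈
      ; head∉    = head∉
      ; forward  = λ _ → forward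
      ; backward = λ (w , matched) h∉w _ → balance region w₀ w matched₀ matched
          (λ 1≤w₀e → forward (matched≢h 1≤w₀e)) backward (λ 1≤we → forward λ { refl → h∉w 1≤we })
      }
      where
      open Exchange covered h w₀ matched₀ w₀h≡0
      open Separation (separated (minimal h))

    config : Config _∈M_ r
    config = record
      { shape       = shape
      ; head∈β      = λ {h} _ → χ-head h
      ; root∉κ      = λ (_ , _ , r≢r) → r≢r refl
      ; covered     = λ {h} _ → let w , matched , 1≤wh = covering-weight {G} covered h in
          (w , matched) , 1≤wh
      ; tail-unique = λ { {w , matched} {g} {h} _ _ 1≤wg 1≤wh eq →
          matched-unique G w matched 1≤wg 1≤wh (tail-incident g)
            (subst (λ v → Incident G v h) (sym eq) (tail-incident h)) }
      ; head-unique = λ { {w , matched} {g} {h} _ _ 1≤wg 1≤wh eq →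
          matched-unique G w matched 1≤wg 1≤wh (head-incident g)
            (subst (λ v → Incident G v h) (sym eq) (head-incident h)) }
      ; head-cover  = λ (w , matched) {b} χb → let e , 1≤we , be = matched-cover G w matched b in
          e , tt , 1≤we , is-head χb be
      ; strong      = λ (w , matched) Z fwd bwd {h} _ →
          strongly-connected covered Z w matched (λ _ → fwd tt) (bwd tt) χr h
      ; cut         = λ {h} _ → cut h
      ; third       = λ {g} {h} _ _ _ (χt , deg≢2 , _) →
          let k , inc-k , k≢g , k≢h = third-edge {G} covered deg≢2 g h in
          k , tt , is-tail χt inc-k , k≢g , k≢h
      }

    open Config config using (Counted?; κ?)

    D? : Decidable (λ v → A₂ v × v ≢ r)
    D? v = A₂? v ×-dec ¬? (v ≟ r)

    -- An edge that is not counted starts in A₂ away from the root, and each such vertex is the tail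
    -- of exactly two edges.
    edge-bound : m G ≤ # Counted? + (# D? + # D?)
    edge-bound = begin
      m G
        ≡⟨ sym (sum-one (m G)) ⟩
      sum {m G} (λ _ → 1)
        ≤⟨ sum-mono-≤ (λ _ → 1) _ (λ e → ⟦⟧-⊎ (yes tt) (Counted? e) (D? (tail e)) (λ _ → place e)) ⟩
      sum (λ e → ⟦ Counted? e ⟧ + ⟦ D? (tail e) ⟧)
        ≡⟨ ∑-distrib-+ (λ e → ⟦ Counted? e ⟧) _ ⟩
      # Counted? + sum (λ e → ⟦ D? (tail e) ⟧)
        ≡⟨ cong (_+_ (# Counted?)) (sum-cong-≗ (λ e → sym (*-identityˡ ⟦ D? (tail e) ⟧))) ⟩
      # Counted? + sum (λ e → 1 * ⟦ D? (tail e) ⟧)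
        ≡⟨ cong (_+_ (# Counted?)) (sym (load-sum-tail (λ _ → 1) D?)) ⟩
      # Counted? + sum (λ v → ⟦ A? v ×-dec D? v ⟧ * load G (λ _ → 1) v)
        ≡⟨ cong (_+_ (# Counted?)) (trans (sum-cong-≗ twice) (∑-distrib-+ (λ v → ⟦ D? v ⟧) _)) ⟩
      # Counted? + (# D? + # D?) ∎
      where
      open ≤-Reasoning
      place : ∀ e → Config.Counted config e ⊎ (A₂ (tail e) × tail e ≢ r)
      place e with tail e ≟ r | degree G (tail e) ℕ.≟ 2
      ... | yes t≡r | _       = inj₁ (tt , inj₂ t≡r)
      ... | no t≢r  | yes d≡2 = inj₂ ((χ-tail e , d≡2) , t≢r)
      ... | no t≢r  | no d≢2  = inj₁ (tt , inj₁ (χ-tail e , d≢2 , t≢r))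

      twice : ∀ v → ⟦ A? v ×-dec D? v ⟧ * load G (λ _ → 1) v ≡ ⟦ D? v ⟧ + ⟦ D? v ⟧
      twice v = trans (cong₂ _*_ (⟦⟧-cong (A? v ×-dec D? v) (D? v) proj₂ (λ d → proj₁ (proj₁ d) , d))
                                 (load-one G v))
                      (double (D? v) (proj₂ ∘ proj₁))
        where
        double : ∀ {X : Set} (x? : Dec X) → (X → degree G v ≡ 2) → ⟦ x? ⟧ * degree G v ≡ ⟦ x? ⟧ + ⟦ x? ⟧
        double (yes x) d≡2 = trans (*-identityˡ _) (d≡2 x)
        double (no _)  _   = refl

    -- The four terms count pairwise disjoint sets, the last one being the root.
    vertex-bound : # κ? + # B? + # D? + 1 ≤ n G
    vertex-bound = begin
      # κ? + # B? + # D? + 1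
        ≡⟨ cong₂ _+_ (cong (_+ # D?) (sym (∑-distrib-+ (λ v → ⟦ κ? v ⟧) _))) (sym (sum-indicator r)) ⟩
      sum (λ v → ⟦ κ? v ⟧ + ⟦ B? v ⟧) + # D? + sum (λ v → ⟦ v ≟ r ⟧)
        ≡⟨ cong (_+ sum (λ v → ⟦ v ≟ r ⟧)) (sym (∑-distrib-+ (λ v → ⟦ κ? v ⟧ + ⟦ B? v ⟧) _)) ⟩
      sum (λ v → ⟦ κ? v ⟧ + ⟦ B? v ⟧ + ⟦ D? v ⟧) + sum (λ v → ⟦ v ≟ r ⟧)
        ≡⟨ sym (∑-distrib-+ (λ v → ⟦ κ? v ⟧ + ⟦ B? v ⟧ + ⟦ D? v ⟧) _) ⟩
      sum (λ v → ⟦ κ? v ⟧ + ⟦ B? v ⟧ + ⟦ D? v ⟧ + ⟦ v ≟ r ⟧)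
        ≤⟨ sum-mono-≤ _ (λ _ → 1) (λ v →
             disjoint (χ v) (degree G v ℕ.≟ 2) (v ≟ r) λ { refl → χr }) ⟩
      sum {n G} (λ _ → 1)
        ≡⟨ sum-one (n G) ⟩
      n G ∎
      where
      open ≤-Reasoning
      disjoint : ∀ b {X Y : Set} (x? : Dec X) (y? : Dec Y) → (Y → b ≡ true) →
        ⟦ (b Bool.≟ true) ×-dec ¬? x? ×-dec ¬? y? ⟧ + ⟦ b Bool.≟ false ⟧ +
        ⟦ ((b Bool.≟ true) ×-dec x?) ×-dec ¬? y? ⟧ + ⟦ y? ⟧ ≤ 1
      disjoint true  (yes _) (yes _) _ = ≤-refl
      disjoint true  (yes _) (no _)  _ = ≤-refl
      disjoint true  (no _)  (yes _) _ = ≤-refl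
      disjoint true  (no _)  (no _)  _ = ≤-refl
      disjoint false x?      (yes y) f = contradiction (f y) λ ()
      disjoint false (yes _) (no _)  _ = ≤-refl
      disjoint false (no _)  (no _)  _ = ≤-refl

    rooted-bound : m G + 1 ≤ n G + # D?
    rooted-bound = begin
      m G + 1                                  ≤⟨ +-monoˡ-≤ 1 edge-bound ⟩
      # Counted? + (# D? + # D?) + 1           ≤⟨ +-monoˡ-≤ 1 (+-monoˡ-≤ (# D? + # D?)
                                                    (config-bound _∈M_ _ config refl)) ⟩
      # κ? + # B? + (# D? + # D?) + 1          ≡⟨ solve 3 (λ k b d → k :+ b :+ (d :+ d) :+ con 1
                                                                  := k :+ b :+ d :+ con 1 :+ d)
                                                    refl (# κ?) (# B?) (# D?) ⟩
      # κ? + # B? + # D? + 1 + # D?            ≤⟨ +-monoˡ-≤ (# D?) vertex-bound ⟩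
      n G + # D?                               ∎
      where
      open ≤-Reasoning
      open +-*-Solver using (solve; _:=_; _:+_; con)

  degree-sum : sum (degree G) ≡ m G + m G
  degree-sum = begin
    sum (degree G)                        ≡⟨ sum-cong-≗ (λ v → sym (trans (*-identityˡ _) (load-one G v))) ⟩
    sum (λ v → 1 * load G (λ _ → 1) v)    ≡⟨ load-sum (λ _ → 1) (λ _ → 1) ⟩
    sum {m G} (λ _ → 1 + 1)               ≡⟨ ∑-distrib-+ {m G} (λ _ → 1) (λ _ → 1) ⟩
    sum {m G} (λ _ → 1) + sum {m G} (λ _ → 1) ≡⟨ cong₂ _+_ (sum-one (m G)) (sum-one (m G)) ⟩
    m G + m G                             ∎
    where open ≡-Reasoning

  -- Handshaking: a vertex of degree two falls short of three by one, and the indicator pays for it.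
  degree-bound : 3 * n G ≤ m G + m G + # (λ v → degree G v ℕ.≟ 2)
  degree-bound = begin
    3 * n G                                           ≡⟨ cong (3 *_) (sym (sum-one (n G))) ⟩
    3 * sum {n G} (λ _ → 1)                           ≡⟨ *-distribˡ-sum {n G} 3 (λ _ → 1) ⟩
    sum {n G} (λ _ → 3)                               ≤⟨ sum-mono-≤ (λ _ → 3) _ at-least-3 ⟩
    sum (λ v → degree G v + ⟦ degree G v ℕ.≟ 2 ⟧)     ≡⟨ ∑-distrib-+ (degree G) _ ⟩
    sum (degree G) + # (λ v → degree G v ℕ.≟ 2)       ≡⟨ cong (_+ # (λ v → degree G v ℕ.≟ 2)) degree-sum ⟩
    m G + m G + # (λ v → degree G v ℕ.≟ 2)            ∎
    where
    open ≤-Reasoning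
    at-least-3 : ∀ v → 3 ≤ degree G v + ⟦ degree G v ℕ.≟ 2 ⟧
    at-least-3 v with degree G v | degree≥2 {G} covered v
    ... | suc zero          | s≤s ()
    ... | suc (suc zero)    | _ = ≤-refl
    ... | suc (suc (suc d)) | _ = s≤s (s≤s (s≤s z≤n))

  n≤m : n G ≤ m G
  n≤m = *-cancelˡ-≤ 2 (begin
    2 * n G                        ≡⟨ cong (2 *_) (sym (sum-one (n G))) ⟩
    2 * sum {n G} (λ _ → 1)        ≡⟨ *-distribˡ-sum {n G} 2 (λ _ → 1) ⟩
    sum {n G} (λ _ → 2)            ≤⟨ sum-mono-≤ (λ _ → 2) (degree G) (degree≥2 {G} covered) ⟩
    sum (degree G)                 ≡⟨ degree-sum ⟩
    m G + m G                      ≡⟨ cong (_+_ (m G)) (sym (+-identityʳ (m G))) ⟩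
    2 * m G                        ∎)
    where open ≤-Reasoning

  -- A root chosen in A₂ is itself one vertex more than `D?` counts. If A₂ were empty, any A-vertex
  -- as root would give `m G + 1 ≤ n G`, against `n≤m`.
  colour-bound : m G + 2 ≤ n G + # A₂?
  colour-bound with any? A₂?
  ... | yes (r , A₂r@(χr , _)) = begin
    m G + 2                  ≡⟨ sym (+-assoc (m G) 1 1) ⟩
    m G + 1 + 1              ≤⟨ +-monoˡ-≤ 1 (rooted-bound χr) ⟩
    n G + # (D? χr) + 1      ≡⟨ trans (+-assoc (n G) (# (D? χr)) 1) (cong (_+_ (n G)) (+-comm (# (D? χr)) 1)) ⟩
    n G + suc (# (D? χr))    ≡⟨ cong (_+_ (n G)) (sym (#-remove A₂? A₂r)) ⟩
    n G + # A₂?              ∎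
    where open ≤-Reasoning
  ... | no none = contradiction (begin
    n G + 1                  ≤⟨ +-monoˡ-≤ 1 n≤m ⟩
    m G + 1                  ≤⟨ rooted-bound (χ-tail e) ⟩
    n G + # (D? (χ-tail e))  ≡⟨ cong (_+_ (n G)) (sum-zero _ (λ v →
                                  ⟦⟧-no (D? (χ-tail e) v) λ (A₂v , _) → none (v , A₂v))) ⟩
    n G + 0                  ∎) (λ n+1≤n+0 → contradiction (+-cancelˡ-≤ (n G) 1 0 n+1≤n+0) λ ())
    where
    open ≤-Reasoning
    e : Edge G
    e = proj₁ (incident-edge {G} covered (some (proj₁ (proj₂ covered))))
      where
      some : ∀ {k} → k ≥ 4 → Fin k
      some (s≤s _) = zero

-- From the two bounds to the containment

∣V₂∣≡# : ∀ G → ∣V₂∣ G ≡ # (λ v → degree G v ℕ.≟ 2)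
∣V₂∣≡# G = length-filter-tabulate (λ v → degree G v ℕ.≟ 2) id

V₂-bound : ∀ {G} → MinimalBipartite G → (m G + 2) + (m G + 2) ≤ n G + n G + ∣V₂∣ G
V₂-bound {G} ((χ , proper) , covered , minimal) = begin
  (m G + 2) + (m G + 2)
    ≤⟨ +-mono-≤ White.colour-bound Black.colour-bound ⟩
  (n G + # White.A₂?) + (n G + # Black.A₂?)
    ≡⟨ solve 3 (λ n a b → (n :+ a) :+ (n :+ b) := n :+ n :+ (a :+ b)) refl
         (n G) (# White.A₂?) (# Black.A₂?) ⟩
  n G + n G + (# White.A₂? + # Black.A₂?)
    ≡⟨ cong (_+_ (n G + n G)) (sym (trans (∣V₂∣≡# G) (trans
         (sum-cong-≗ (λ v → split (χ v) (degree G v ℕ.≟ 2))) (∑-distrib-+ (λ v → ⟦ White.A₂? v ⟧) _)))) ⟩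
  n G + n G + ∣V₂∣ G ∎
  where
  open ≤-Reasoning
  open +-*-Solver using (solve; _:=_; _:+_; con)
  module White = MinimalBound {G} covered minimal χ proper
  -- Exchanging the colours turns the other class into the class of tails.
  module Black = MinimalBound {G} covered minimal (not ∘ χ) (λ e → proper e ∘ not-injective)
  split : ∀ b {X : Set} (x? : Dec X) →
    ⟦ x? ⟧ ≡ ⟦ (b Bool.≟ true) ×-dec x? ⟧ + ⟦ (not b Bool.≟ true) ×-dec x? ⟧
  split true  (yes _) = refl
  split true  (no _)  = refl
  split false (yes _) = refl
  split false (no _)  = refl

-- The prescribed `v` satisfies `v + v ≤ n + 4`; adding this to the degree inequality gives the
-- reverse of the lower bound.
tight-counts : ∀ m n v → (m + 2) + (m + 2) ≤ n + n + v → 3 * n ≤ m + m + v → v ≡ n / 2 + 2 →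
               (m + 2) + (m + 2) ≡ n + n + v
tight-counts m n v lower degrees v≡n/2+2 = ≤-antisym lower (+-cancelʳ-≤ (n + v) _ _ (begin
  n + n + v + (n + v)
    ≡⟨ solve 2 (λ n v → n :+ n :+ v :+ (n :+ v) := con 3 :* n :+ (v :+ v)) refl n v ⟩
  3 * n + (v + v)
    ≤⟨ +-mono-≤ degrees 2v≤n+4 ⟩
  m + m + v + (n + 4)
    ≡⟨ solve 3 (λ m n v → m :+ m :+ v :+ (n :+ con 4) := (m :+ con 2) :+ (m :+ con 2) :+ (n :+ v))
         refl m n v ⟩
  (m + 2) + (m + 2) + (n + v) ∎))
  where
  open ≤-Reasoning
  open +-*-Solver using (solve; _:=_; _:+_; _:*_; con)
  2v≤n+4 : v + v ≤ n + 4
  2v≤n+4 = begin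
    v + v                      ≡⟨ cong (λ x → x + x) v≡n/2+2 ⟩
    (n / 2 + 2) + (n / 2 + 2)  ≡⟨ solve 1 (λ q → (q :+ con 2) :+ (q :+ con 2) := q :* con 2 :+ con 4)
                                    refl (n / 2) ⟩
    -- Rounding down in `n / 2` goes in the direction wanted here.
    n / 2 * 2 + 4              ≤⟨ +-monoˡ-≤ 4 (m/n*n≤m n 2) ⟩
    n + 4                      ∎

integer-form : ∀ m n v → (m + 2) + (m + 2) ≡ n + n + v →
  ℤ.+ v ≡ ℤ.+ 2 ℤ.* (ℤ.+ m ℤ.- ℤ.+ n ℤ.+ ℤ.+ 2)
integer-form m n v eq = begin
  + v
    ≡⟨ solve 2 (λ v k → v := k :+ v :- k) refl (+ v) (+ (n + n)) ⟩
  + (n + n + v) ℤ.- + (n + n)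
    ≡⟨ cong (λ x → + x ℤ.- + (n + n)) (sym eq) ⟩
  + ((m + 2) + (m + 2)) ℤ.- + (n + n)
    ≡⟨ solve 2 (λ m n → (m :+ con (+ 2)) :+ (m :+ con (+ 2)) :- (n :+ n)
                     := con (+ 2) :* (m :- n :+ con (+ 2)))
         refl (+ m) (+ n) ⟩
  + 2 ℤ.* (+ m ℤ.- + n ℤ.+ + 2) ∎
  where
  open ≡-Reasoning
  open ℤ using (+_)
  open ℤ-Solver using (solve; _:=_; _:+_; _:-_; _:*_; con)

H₃⊆H₂ : H₃ ⊆ H₂
H₃⊆H₂ {G} (mb@((χ , proper) , covered , minimal) , extremal) = mb ,
  integer-form (m G) (n G) (∣V₂∣ G) (tight-counts (m G) (n G) (∣V₂∣ G) (V₂-bound {G} mb)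
    (subst (λ x → 3 * n G ≤ m G + m G + x) (sym (∣V₂∣≡# G))
      (MinimalBound.degree-bound {G} covered minimal χ proper)) extremal)

-- A graph in H₂ outside H₃

-- Two copies of the star K₁,₄, with centres 0F and 9F, whose corresponding
-- leaves are joined.
twinStarEnds : Vec (Fin 10 × Fin 10) 12
twinStarEnds =
  (0F , 1F) ∷ (0F , 2F) ∷ (0F , 3F) ∷ (0F , 4F) ∷
  (1F , 5F) ∷ (2F , 6F) ∷ (3F , 7F) ∷ (4F , 8F) ∷
  (5F , 9F) ∷ (6F , 9F) ∷ (7F , 9F) ∷ (8F , 9F) ∷ []

twinStar : Graph
twinStar = mkGraph 10 12 (lookup twinStarEnds)
  (from-yes (all? λ e → ¬? (proj₁ (lookup twinStarEnds e) ≟ proj₂ (lookup twinStarEnds e))))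

twinStar-bipartite : Bipartite twinStar
twinStar-bipartite = lookup colours ,
  from-yes (all? λ e → ¬? (lookup colours (proj₁ (ends twinStar e)) Bool.≟
                           lookup colours (proj₂ (ends twinStar e))))
  where
  colours : Vec Bool 10
  colours = true ∷ false ∷ false ∷ false ∷ false ∷ true ∷ true ∷ true ∷ true ∷ false ∷ []

twinStar-connected : Connected twinStar
twinStar-connected u v = to-centre u ◅◅ reverse adjacent-sym (to-centre v)
  where
  adjacent-sym : ∀ {u v} → Adjacent twinStar u v → Adjacent twinStar v u
  adjacent-sym (u≢v , e , ue , ve) = u≢v ∘ sym , e , ve , ue

  back : ∀ e → Adjacent twinStar (proj₂ (ends twinStar e)) (proj₁ (ends twinStar e))
  back e = loopless twinStar e ∘ sym , e , inj₂ refl , inj₁ refl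

  to-centre : ∀ v → Star (Adjacent twinStar) v 0F
  to-centre 0F = nil
  to-centre 1F = back 0F ◅ nil
  to-centre 2F = back 1F ◅ nil
  to-centre 3F = back 2F ◅ nil
  to-centre 4F = back 3F ◅ nil
  to-centre 5F = back 4F ◅ back 0F ◅ nil
  to-centre 6F = back 5F ◅ back 1F ◅ nil
  to-centre 7F = back 6F ◅ back 2F ◅ nil
  to-centre 8F = back 7F ◅ back 3F ◅ nil
  to-centre 9F = back 8F ◅ back 4F ◅ back 0F ◅ nil

-- The perfect matching that uses both star edges of leg i and the middle edge
-- of every other leg; edge number 4k + j is the k-th edge of leg j.
leg-matching : Fin 4 → Edge twinStar → ℕ
leg-matching i e with quotRem {3} 4 e
... | j , 1F = ⟦ ¬? (j ≟ i) ⟧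
... | j , _  = ⟦ j ≟ i ⟧

twinStar-matchingCovered : MatchingCovered twinStar
twinStar-matchingCovered = twinStar-connected , s≤s (s≤s (s≤s (s≤s z≤n))) , cover
  where
  matched : ∀ i → Matched twinStar (leg-matching i)
  matched = from-yes (all? λ i → all? λ v → load twinStar (leg-matching i) v ℕ.≟ 1)

  used : ∀ e → ∃ λ i → 1 ≤ leg-matching i e
  used = from-yes (all? λ e → any? λ i → 1 ≤? leg-matching i e)

  cover : ∀ e → ∃ λ M → PerfectMatching twinStar M × e ∈ M
  cover e with used e
  ... | i , 1≤w = support twinStar (leg-matching i) ,
    matched⇒perfect twinStar (leg-matching i) (matched i) , support⁺ twinStar (leg-matching i) 1≤w

-- Every edge has a leaf of one of the stars as an end. Leaves have degree two here, so deleting an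
-- edge leaves a vertex of degree one.
twinStar-minimal : ∀ e → ¬ MatchingCovered (delete twinStar e)
twinStar-minimal e covered with low-degree e
  where
  low-degree : ∀ e → ∃ λ v → degree (delete twinStar e) v < 2
  low-degree = from-yes (all? λ e → any? λ v → degree (delete twinStar e) v <? 2)
... | v , deg<2 = ≤⇒≯ (degree≥2 {delete twinStar e} covered v) deg<2

twinStar∈H₂ : H₂ twinStar
-- The closing `refl` evaluates both sides to 8 = 2(12 - 10 + 2).
twinStar∈H₂ = (twinStar-bipartite , twinStar-matchingCovered , twinStar-minimal) , refl

-- The required equation would read 8 = 10 / 2 + 2 = 7.
twinStar∉H₃ : ¬ H₃ twinStar
twinStar∉H₃ (_ , ())

corollary7p2 : H₃ ⊂ H₂
corollary7p2 = (λ {G} → H₃⊆H₂ {G}) , λ H₂⊆H₃ → twinStar∉H₃ (H₂⊆H₃ {twinStar} twinStar∈H₂)
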